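{- Let $\mathsf{L}\in\{\mathsf{CN4K},\mathsf{CN4K}^\pm,\mathsf{CN4K}^\curlyvee,\mathsf{CN4K}^{\Join},\mathsf{CN4K}^1\}$, $\Gamma$ a finite multiset of formulas and $\phi$ a formula. If $\mathsf{L}\models\bigwedge_{\psi\in\Gamma}\psi\to\phi$ (for $\Gamma$ empty: $\mathsf{L}\models\phi$), then the sequent $\Gamma\Rightarrow\phi$ is provable in $\mathcal{G}\mathsf{L}$.
   Context: Fix a countable set $\mathsf{Prop}$ of propositional variables. The language $\mathcal{L}$ is given by the grammar $\phi::=p\mid{\sim}\phi\mid(\phi\wedge\phi)\mid(\phi\vee\phi)\mid(\phi\to\phi)\mid\Box\phi\mid\Diamond\phi$ with $p\in\mathsf{Prop}$. Semantics. A $\mathsf{CN4K}$ frame is $\langle W,\le,R^+_\Box,R^-_\Box,R^+_\Diamond,R^-_\Diamond\rangle$ with $W\ne\varnothing$, $\le$ a preorder on $W$, and four arbitrary binary relations; $R(w)=\{w'\mid wRw'\}$. It is $\pm$-birelational if $R^+_\Box=R^+_\Diamond$ and $R^-_\Box=R^-_\Diamond$; $\curlyvee$-birelational if $R^+_\Box=R^-_\Box$ and $R^+_\Diamond=R^-_\Diamond$; $\Join$-birelational if $R^+_\Box=R^-_\Diamond$ and $R^+_\Diamond=R^-_\Box$; monorelational if all four coincide. A model adds $v^+,v^-:\mathsf{Prop}\to2^W$ upward closed under $\le$. Support: $w\Vdash^\pm p$ iff $w\in v^\pm(p)$; $w\Vdash^+{\sim}\phi$ iff $w\Vdash^-\phi$;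 $w\Vdash^-{\sim}\phi$ iff $w\Vdash^+\phi$; $w\Vdash^+\phi\wedge\chi$ iff both; $w\Vdash^-\phi\wedge\chi$ iff $w\Vdash^-\phi$ or $w\Vdash^-\chi$; $w\Vdash^+\phi\vee\chi$ iff $w\Vdash^+\phi$ or $w\Vdash^+\chi$; $w\Vdash^-\phi\vee\chi$ iff both negatively supported; $w\Vdash^+\phi\to\chi$ iff for all $w'\ge w$, $w'\Vdash^+\phi$ implies $w'\Vdash^+\chi$; $w\Vdash^-\phi\to\chi$ iff $w\Vdash^+\phi$ and $w\Vdash^-\chi$; $w\Vdash^+\Box\phi$ iff $\forall w'\ge w\ \forall w''\in R^+_\Box(w')$: $w''\Vdash^+\phi$; $w\Vdash^-\Box\phi$ iff $\forall w'\ge w\ \exists w''\in R^-_\Box(w')$: $w''\Vdash^-\phi$; $w\Vdash^+\Diamond\phi$ iff $\forall w'\ge w\ \exists w''\in R^+_\Diamond(w')$: $w''\Vdash^+\phi$; $w\Vdash^-\Diamond\phi$ iff $\forall w'\ge w\ \forall w''\in R^-_\Diamond(w')$: $w''\Vdash^-\phi$. $\mathsf{CN4K}$, $\mathsf{CN4K}^\pm$, $\mathsf{CN4K}^\curlyvee$, $\mathsf{CN4K}^{\Join}$, $\mathsf{CN4K}^1$ are the logics of all frames, $\pm$-, $\curlyvee$-, $\Join$-birelational, and monorelational frames, resp.; $\mathsf{L}\models\chi$ means $\mathfrak{M},w\Vdash^+\chi$ for every model $\mathfrak{M}$ on a frame of the class of $\mathsf{L}$ and every state $w$. Sequents. A sequent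 is $\Gamma\Rightarrow\phi$ with $\Gamma$ a finite multiset of formulas and $\phi$ a single formula. $\Gamma^\Box=\{\phi\mid\Box\phi\in\Gamma\}$, $\Gamma^\Diamond_\sim=\{{\sim}\phi\mid{\sim}\Diamond\phi\in\Gamma\}$ (multisets). Rules are written premise(s) / conclusion. Rules of $\mathcal{G}\mathsf{N4}$: axioms $p,\Gamma\Rightarrow p$ and ${\sim}p,\Gamma\Rightarrow{\sim}p$ ($p\in\mathsf{Prop}$); ${\sim}{\sim}_l$: $\phi,\Gamma\Rightarrow\psi$ / ${\sim}{\sim}\phi,\Gamma\Rightarrow\psi$; ${\sim}{\sim}_r$: $\Gamma\Rightarrow\phi$ / $\Gamma\Rightarrow{\sim}{\sim}\phi$; $\wedge_l$: $\phi,\chi,\Gamma\Rightarrow\psi$ / $\phi\wedge\chi,\Gamma\Rightarrow\psi$; $\wedge_r$: $\Gamma\Rightarrow\phi$ and $\Gamma\Rightarrow\chi$ / $\Gamma\Rightarrow\phi\wedge\chi$; $\vee_l$: $\phi,\Gamma\Rightarrow\psi$ and $\chi,\Gamma\Rightarrow\psi$ / $\phi\vee\chi,\Gamma\Rightarrow\psi$; $\vee_{r_1}$: $\Gamma\Rightarrow\phi$ / $\Gamma\Rightarrow\phi\vee\chi$; $\vee_{r_2}$: $\Gamma\Rightarrow\chi$ / $\Gamma\Rightarrow\phi\vee\chi$; ${\sim}\vee_l$: ${\sim}\phi,{\sim}\chi,\Gamma\Rightarrow\psi$ / ${\sim}(\phi\vee\chi),\Gamma\Rightarrow\psi$; ${\sim}\vee_r$: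 $\Gamma\Rightarrow{\sim}\phi$ and $\Gamma\Rightarrow{\sim}\chi$ / $\Gamma\Rightarrow{\sim}(\phi\vee\chi)$; ${\sim}\wedge_l$: ${\sim}\phi,\Gamma\Rightarrow\psi$ and ${\sim}\chi,\Gamma\Rightarrow\psi$ / ${\sim}(\phi\wedge\chi),\Gamma\Rightarrow\psi$; ${\sim}\wedge_{r_1}$: $\Gamma\Rightarrow{\sim}\phi$ / $\Gamma\Rightarrow{\sim}(\phi\wedge\chi)$; ${\sim}\wedge_{r_2}$: $\Gamma\Rightarrow{\sim}\chi$ / $\Gamma\Rightarrow{\sim}(\phi\wedge\chi)$; $\to_l$: $\phi\to\chi,\Gamma\Rightarrow\phi$ and $\chi,\Gamma\Rightarrow\psi$ / $\phi\to\chi,\Gamma\Rightarrow\psi$; $\to_r$: $\Gamma,\phi\Rightarrow\chi$ / $\Gamma\Rightarrow\phi\to\chi$; ${\sim}\!\to_l$: $\phi,{\sim}\chi,\Gamma\Rightarrow\psi$ / ${\sim}(\phi\to\chi),\Gamma\Rightarrow\psi$; ${\sim}\!\to_r$: $\Gamma\Rightarrow\phi$ and $\Gamma\Rightarrow{\sim}\chi$ / $\Gamma\Rightarrow{\sim}(\phi\to\chi)$. Modal rules: $\Box$: $\Gamma^\Box\Rightarrow\chi$ / $\Gamma\Rightarrow\Box\chi$; $\Diamond$: $\phi\Rightarrow\chi$ / $\Gamma,\Diamond\phi\Rightarrow\Diamond\chi$; $\Box_\sim$: ${\sim}\phi\Rightarrow{\sim}\chi$ / $\Gamma,{\sim}\Box\phi\Rightarrow{\sim}\Box\chi$;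 $\Diamond_\sim$: $\Gamma^\Diamond_\sim\Rightarrow{\sim}\chi$ / $\Gamma\Rightarrow{\sim}\Diamond\chi$; $\Diamond^\pm$: $\Gamma^\Box,\phi\Rightarrow\chi$ / $\Gamma,\Diamond\phi\Rightarrow\Diamond\chi$; $\Box^\pm_\sim$: $\Gamma^\Diamond_\sim,{\sim}\phi\Rightarrow{\sim}\chi$ / $\Gamma,{\sim}\Box\phi\Rightarrow{\sim}\Box\chi$; $\Diamond^\curlyvee$: $\Gamma^\Diamond_\sim,\phi\Rightarrow\chi$ / $\Gamma,\Diamond\phi\Rightarrow\Diamond\chi$; $\Box^\curlyvee_\sim$: $\Gamma^\Box,{\sim}\phi\Rightarrow{\sim}\chi$ / $\Gamma,{\sim}\Box\phi\Rightarrow{\sim}\Box\chi$; $\Box^{\Join}$: $\Gamma^\Box,\Gamma^\Diamond_\sim\Rightarrow\chi$ / $\Gamma\Rightarrow\Box\chi$; $\Diamond^{\Join}$: ${\sim}\phi\Rightarrow\chi$ / $\Gamma,{\sim}\Box\phi\Rightarrow\Diamond\chi$; $\Box^{\Join}_\sim$: $\phi\Rightarrow{\sim}\chi$ / $\Gamma,\Diamond\phi\Rightarrow{\sim}\Box\chi$; $\Diamond^{\Join}_\sim$: $\Gamma^\Box,\Gamma^\Diamond_\sim\Rightarrow{\sim}\chi$ / $\Gamma\Rightarrow{\sim}\Diamond\chi$; $\Diamond^1$: $\Gamma^\Box,\Gamma^\Diamond_\sim,\phi\Rightarrow\chi$ / $\Gamma,\Diamond\phi\Rightarrow\Diamond\chi$;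 $\Box^1_\sim$: $\Gamma^\Box,\Gamma^\Diamond_\sim,{\sim}\phi\Rightarrow{\sim}\chi$ / $\Gamma,{\sim}\Box\phi\Rightarrow{\sim}\Box\chi$; $\Diamond^{1,\Join}$: $\Gamma^\Box,\Gamma^\Diamond_\sim,{\sim}\phi\Rightarrow\chi$ / $\Gamma,{\sim}\Box\phi\Rightarrow\Diamond\chi$; $\Box^{1,\Join}_\sim$: $\Gamma^\Box,\Gamma^\Diamond_\sim,\phi\Rightarrow{\sim}\chi$ / $\Gamma,\Diamond\phi\Rightarrow{\sim}\Box\chi$. Calculi: $\mathcal{G}\mathsf{CN4K}=\mathcal{G}\mathsf{N4}+\{\Box,\Diamond,\Box_\sim,\Diamond_\sim\}$; $\mathcal{G}\mathsf{CN4K}^\curlyvee=\mathcal{G}\mathsf{N4}+\{\Box,\Diamond^\curlyvee,\Box^\curlyvee_\sim,\Diamond_\sim\}$; $\mathcal{G}\mathsf{CN4K}^\pm=\mathcal{G}\mathsf{N4}+\{\Box,\Diamond^\pm,\Box^\pm_\sim,\Diamond_\sim\}$; $\mathcal{G}\mathsf{CN4K}^{\Join}=\mathcal{G}\mathsf{N4}+\{\Box^{\Join},\Diamond,\Diamond^{\Join},\Box_\sim,\Box^{\Join}_\sim,\Diamond^{\Join}_\sim\}$; $\mathcal{G}\mathsf{CN4K}^1=\mathcal{G}\mathsf{N4}+\{\Box^{\Join},\Diamond^1,\Diamond^{1,\Join},\Box^1_\sim,\Box^{1,\Join}_\sim,\Diamond^{\Join}_\sim\}$. A proof is a finite tree of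 sequents, each node obtained from its children by a rule, whose leaves are axioms. -}

module Defs where

open import Data.List.Base using (List; []; _∷_; [_]; _++_; mapMaybe)
open import Data.List.Membership.Propositional using (_∈_)
open import Data.List.NonEmpty as List⁺ using (foldr₁)
open import Data.List.Relation.Binary.Permutation.Propositional using (_↭_)
open import Data.List.Relation.Unary.All using (All)
open import Data.Maybe.Base using (Maybe; just; nothing)
open import Data.Product.Base using (_×_; ∃-syntax)
open import Data.Sum.Base using (_⊎_)
open import Data.Unit.Base using (⊤)
open import Level using (0ℓ)
open import Relation.Binary.Core using (Rel; _⇔_)
open import Relation.Binary.PropositionalEquality.Core using (_≡_)
open import Relation.Binary.Structures using (IsPreorder)
open import Relation.Unary using (Pred)

infix  9 ∼_ □_ ◇_
infixr 8 _∧_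
infixr 7 _∨_
infixr 6 _⊃_ _⋀⊃_
infix  4 _⇒_
infix  3 _⊨_ _⊢_

-- `_⊃_` is the implication of the object language.
data Formula (Var : Set) : Set where
  var : Var → Formula Var
  ∼_ : Formula Var → Formula Var
  _∧_ _∨_ _⊃_ : Formula Var → Formula Var → Formula Var
  □_ ◇_ : Formula Var → Formula Var

private variable
  Var : Set

------------------------------------------------------------------------
-- Semantics

record Frame : Set₁ where
  field
    W : Set
    nonempty : W
    _≤_ : Rel W 0ℓ
    isPreorder : IsPreorder _≡_ _≤_
    R□⁺ R□⁻ R◇⁺ R◇⁻ : Rel W 0ℓ

record Model (Var : Set) (F : Frame) : Set₁ where
  open Frame F
  field
    v⁺ v⁻ : Var → Pred W 0ℓ
    v⁺-upward : ∀ p {w w′} → w ≤ w′ → v⁺ p w → v⁺ p w′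
    v⁻-upward : ∀ p {w w′} → w ≤ w′ → v⁻ p w → v⁻ p w′

module _ {F : Frame} (M : Model Var F) where
  open Frame F
  open Model M

  infix 4 _⊩⁺_ _⊩⁻_

  mutual
    _⊩⁺_ : W → Formula Var → Set
    w ⊩⁺ var p = v⁺ p w
    w ⊩⁺ ∼ φ = w ⊩⁻ φ
    w ⊩⁺ φ ∧ χ = w ⊩⁺ φ × w ⊩⁺ χ
    w ⊩⁺ φ ∨ χ = w ⊩⁺ φ ⊎ w ⊩⁺ χ
    w ⊩⁺ φ ⊃ χ = ∀ w′ → w ≤ w′ → w′ ⊩⁺ φ → w′ ⊩⁺ χ
    w ⊩⁺ □ φ = ∀ w′ → w ≤ w′ → ∀ w″ → R□⁺ w′ w″ → w″ ⊩⁺ φ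
    w ⊩⁺ ◇ φ = ∀ w′ → w ≤ w′ → ∃[ w″ ] (R◇⁺ w′ w″ × w″ ⊩⁺ φ)

    _⊩⁻_ : W → Formula Var → Set
    w ⊩⁻ var p = v⁻ p w
    w ⊩⁻ ∼ φ = w ⊩⁺ φ
    w ⊩⁻ φ ∧ χ = w ⊩⁻ φ ⊎ w ⊩⁻ χ
    w ⊩⁻ φ ∨ χ = w ⊩⁻ φ × w ⊩⁻ χ
    w ⊩⁻ φ ⊃ χ = w ⊩⁺ φ × w ⊩⁻ χ
    w ⊩⁻ □ φ = ∀ w′ → w ≤ w′ → ∃[ w″ ] (R□⁻ w′ w″ × w″ ⊩⁻ φ)
    w ⊩⁻ ◇ φ = ∀ w′ → w ≤ w′ → ∀ w″ → R◇⁻ w′ w″ → w″ ⊩⁻ φ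

data Logic : Set where
  CN4K CN4K± CN4K⋎ CN4K⋈ CN4K¹ : Logic

-- Frame relations are compared extensionally: `_⇔_` is mutual inclusion.
FrameOf : Logic → Frame → Set
FrameOf CN4K  F = ⊤
FrameOf CN4K± F = R□⁺ ⇔ R◇⁺ × R□⁻ ⇔ R◇⁻ where open Frame F
FrameOf CN4K⋎ F = R□⁺ ⇔ R□⁻ × R◇⁺ ⇔ R◇⁻ where open Frame F
FrameOf CN4K⋈ F = R□⁺ ⇔ R◇⁻ × R◇⁺ ⇔ R□⁻ where open Frame F
FrameOf CN4K¹ F = R□⁺ ⇔ R□⁻ × R□⁻ ⇔ R◇⁺ × R◇⁺ ⇔ R◇⁻ where open Frame F

_⊨_ : Logic → Formula Var → Set₁
_⊨_ {Var} L χ =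
  (F : Frame) → FrameOf L F → (M : Model Var F) (w : Frame.W F) → _⊩⁺_ M w χ

-- `Γ ⋀⊃ φ` is ⋀Γ ⊃ φ for nonempty Γ; the language has no ⊤, so for
-- empty Γ it is φ itself.
_⋀⊃_ : List (Formula Var) → Formula Var → Formula Var
[]      ⋀⊃ φ = φ
(ψ ∷ Γ) ⋀⊃ φ = foldr₁ _∧_ (ψ List⁺.∷ Γ) ⊃ φ

------------------------------------------------------------------------
-- Sequent calculi

-- Antecedents are finite multisets, represented as lists; lists that are
-- permutations of each other are identified in `_⊢_` below.
record Sequent (Var : Set) : Set where
  constructor _⇒_
  field
    antecedent : List (Formula Var)
    succedent  : Formula Var

un□ : Formula Var → Maybe (Formula Var)
un□ (□ φ) = just φ
un□ _     = nothing

un∼◇ : Formula Var → Maybe (Formula Var)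
un∼◇ (∼ ◇ φ) = just (∼ φ)
un∼◇ _       = nothing

-- Γ ^□ = {φ | □φ ∈ Γ}
_^□ : List (Formula Var) → List (Formula Var)
_^□ = mapMaybe un□

-- Γ ^∼◇ = {∼φ | ∼◇φ ∈ Γ}
_^∼◇ : List (Formula Var) → List (Formula Var)
_^∼◇ = mapMaybe un∼◇

private variable
  p : Var
  φ χ ψ : Formula Var
  Γ Δ : List (Formula Var)
  S : List (Sequent Var)

-- `GN4 premises conclusion`
data GN4 {Var : Set} : List (Sequent Var) → Sequent Var → Set where
  ax   : GN4 [] (var p ∷ Γ ⇒ var p)
  ax∼  : GN4 [] (∼ var p ∷ Γ ⇒ ∼ var p)
  ∼∼l  : GN4 [ φ ∷ Γ ⇒ ψ ] (∼ ∼ φ ∷ Γ ⇒ ψ)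
  ∼∼r  : GN4 [ Γ ⇒ φ ] (Γ ⇒ ∼ ∼ φ)
  ∧l   : GN4 [ φ ∷ χ ∷ Γ ⇒ ψ ] (φ ∧ χ ∷ Γ ⇒ ψ)
  ∧r   : GN4 ((Γ ⇒ φ) ∷ (Γ ⇒ χ) ∷ []) (Γ ⇒ φ ∧ χ)
  ∨l   : GN4 ((φ ∷ Γ ⇒ ψ) ∷ (χ ∷ Γ ⇒ ψ) ∷ []) (φ ∨ χ ∷ Γ ⇒ ψ)
  ∨r₁  : GN4 [ Γ ⇒ φ ] (Γ ⇒ φ ∨ χ)
  ∨r₂  : GN4 [ Γ ⇒ χ ] (Γ ⇒ φ ∨ χ)
  ∼∨l  : GN4 [ ∼ φ ∷ ∼ χ ∷ Γ ⇒ ψ ] (∼ (φ ∨ χ) ∷ Γ ⇒ ψ)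
  ∼∨r  : GN4 ((Γ ⇒ ∼ φ) ∷ (Γ ⇒ ∼ χ) ∷ []) (Γ ⇒ ∼ (φ ∨ χ))
  ∼∧l  : GN4 ((∼ φ ∷ Γ ⇒ ψ) ∷ (∼ χ ∷ Γ ⇒ ψ) ∷ []) (∼ (φ ∧ χ) ∷ Γ ⇒ ψ)
  ∼∧r₁ : GN4 [ Γ ⇒ ∼ φ ] (Γ ⇒ ∼ (φ ∧ χ))
  ∼∧r₂ : GN4 [ Γ ⇒ ∼ χ ] (Γ ⇒ ∼ (φ ∧ χ))
  ⊃l   : GN4 ((φ ⊃ χ ∷ Γ ⇒ φ) ∷ (χ ∷ Γ ⇒ ψ) ∷ []) (φ ⊃ χ ∷ Γ ⇒ ψ)
  ⊃r   : GN4 [ φ ∷ Γ ⇒ χ ] (Γ ⇒ φ ⊃ χ)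
  ∼⊃l  : GN4 [ φ ∷ ∼ χ ∷ Γ ⇒ ψ ] (∼ (φ ⊃ χ) ∷ Γ ⇒ ψ)
  ∼⊃r  : GN4 ((Γ ⇒ φ) ∷ (Γ ⇒ ∼ χ) ∷ []) (Γ ⇒ ∼ (φ ⊃ χ))

data ModalRule : Set where
  [□] [◇] [□∼] [◇∼]         : ModalRule
  [◇±] [□∼±]                : ModalRule
  [◇⋎] [□∼⋎]                : ModalRule
  [□⋈] [◇⋈] [□∼⋈] [◇∼⋈]     : ModalRule
  [◇¹] [□∼¹] [◇¹⋈] [□∼¹⋈]   : ModalRule

-- `Instance r premises conclusion`
data Instance {Var : Set} : ModalRule → List (Sequent Var) → Sequent Var → Set where
  □r    : Instance [□]    [ Γ ^□ ⇒ χ ]                     (Γ ⇒ □ χ)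
  ◇r    : Instance [◇]    [ [ φ ] ⇒ χ ]                    (◇ φ ∷ Γ ⇒ ◇ χ)
  □∼r   : Instance [□∼]   [ [ ∼ φ ] ⇒ ∼ χ ]                (∼ □ φ ∷ Γ ⇒ ∼ □ χ)
  ◇∼r   : Instance [◇∼]   [ Γ ^∼◇ ⇒ ∼ χ ]                  (Γ ⇒ ∼ ◇ χ)
  ◇±r   : Instance [◇±]   [ φ ∷ Γ ^□ ⇒ χ ]                 (◇ φ ∷ Γ ⇒ ◇ χ)
  □∼±r  : Instance [□∼±]  [ ∼ φ ∷ Γ ^∼◇ ⇒ ∼ χ ]            (∼ □ φ ∷ Γ ⇒ ∼ □ χ)
  ◇⋎r   : Instance [◇⋎]   [ φ ∷ Γ ^∼◇ ⇒ χ ]                (◇ φ ∷ Γ ⇒ ◇ χ)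
  □∼⋎r  : Instance [□∼⋎]  [ ∼ φ ∷ Γ ^□ ⇒ ∼ χ ]             (∼ □ φ ∷ Γ ⇒ ∼ □ χ)
  □⋈r   : Instance [□⋈]   [ Γ ^□ ++ Γ ^∼◇ ⇒ χ ]            (Γ ⇒ □ χ)
  ◇⋈r   : Instance [◇⋈]   [ [ ∼ φ ] ⇒ χ ]                  (∼ □ φ ∷ Γ ⇒ ◇ χ)
  □∼⋈r  : Instance [□∼⋈]  [ [ φ ] ⇒ ∼ χ ]                  (◇ φ ∷ Γ ⇒ ∼ □ χ)
  ◇∼⋈r  : Instance [◇∼⋈]  [ Γ ^□ ++ Γ ^∼◇ ⇒ ∼ χ ]          (Γ ⇒ ∼ ◇ χ)
  ◇¹r   : Instance [◇¹]   [ φ ∷ Γ ^□ ++ Γ ^∼◇ ⇒ χ ]        (◇ φ ∷ Γ ⇒ ◇ χ)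
  □∼¹r  : Instance [□∼¹]  [ ∼ φ ∷ Γ ^□ ++ Γ ^∼◇ ⇒ ∼ χ ]    (∼ □ φ ∷ Γ ⇒ ∼ □ χ)
  ◇¹⋈r  : Instance [◇¹⋈]  [ ∼ φ ∷ Γ ^□ ++ Γ ^∼◇ ⇒ χ ]      (∼ □ φ ∷ Γ ⇒ ◇ χ)
  □∼¹⋈r : Instance [□∼¹⋈] [ φ ∷ Γ ^□ ++ Γ ^∼◇ ⇒ ∼ χ ]      (◇ φ ∷ Γ ⇒ ∼ □ χ)

modalRules : Logic → List ModalRule
modalRules CN4K  = [□] ∷ [◇] ∷ [□∼] ∷ [◇∼] ∷ []
modalRules CN4K± = [□] ∷ [◇±] ∷ [□∼±] ∷ [◇∼] ∷ []
modalRules CN4K⋎ = [□] ∷ [◇⋎] ∷ [□∼⋎] ∷ [◇∼] ∷ []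
modalRules CN4K⋈ = [□⋈] ∷ [◇] ∷ [◇⋈] ∷ [□∼] ∷ [□∼⋈] ∷ [◇∼⋈] ∷ []
modalRules CN4K¹ = [□⋈] ∷ [◇¹] ∷ [◇¹⋈] ∷ [□∼¹] ∷ [□∼¹⋈] ∷ [◇∼⋈] ∷ []

Rule : Logic → List (Sequent Var) → Sequent Var → Set
Rule L S s = GN4 S s ⊎ ∃[ r ] (r ∈ modalRules L × Instance r S s)

-- `L ⊢ s` is the type of proofs of s in the calculus of L. The premise
-- Γ ↭ Δ says that Γ and Δ are the same multiset.
data _⊢_ {Var : Set} (L : Logic) : Sequent Var → Set where
  by : Rule L S (Δ ⇒ φ) → Γ ↭ Δ → All (L ⊢_) S → L ⊢ (Γ ⇒ φ)

{-# OPTIONS --safe #-}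
module Submission where

-- The calculus, read as a set of backward steps on sequents over a finite
-- set S closed under subformulas, has a computable least fixpoint; this makes
-- derivability over S decidable, so that the countermodel can be built
-- constructively. Its worlds are the contexts to which no left rule applies,
-- each with an optional test (m , χ): as several underivable possibilities
-- cannot always be refuted at once, a world may bar the successors along the
-- relation of m that derive χ, and the order ignores the test. A formula
-- represented at a world is forced there, and a formula forced there is
-- derivable from its context; neither direction uses cut.

open import Algebra.Properties.CommutativeSemigroup using (x∙yz≈y∙xz)
open import Data.Bool.Base using (Bool; true; false)
open import Data.Empty using (⊥; ⊥-elim)
open import Data.Fin.Base using (Fin)
import Data.Fin.Properties as Fin
open import Data.Fin.Patterns using (0F; 1F; 2F; 3F; 4F; 5F)
open import Data.List.Base
  using (List; []; _∷_; [_]; _++_; map; filter; length; concatMap; cartesianProduct;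
    mapMaybe)
open import Data.Nat.ListAction using (sum)
open import Data.Nat.ListAction.Properties using (sum-++)
open import Data.List.Properties using (map-++; filter-notAll)
import Data.List.Properties as List
open import Data.List.Membership.Propositional using (_∈_; find; lose)
open import Data.List.Membership.Propositional.Properties
  using (∈-++⁺ˡ; ∈-++⁺ʳ; ∈-++⁻; ∈-map⁺; ∈-∃++; ∈-filter⁺; ∈-filter⁻;
    ∈-cartesianProduct⁺)
import Data.List.Membership.DecPropositional as DecMembership
open import Data.List.NonEmpty.Base using (foldr₁; _∷_)
open import Data.List.Relation.Binary.Permutation.Propositional using (_↭_; ↭-refl)
open import Data.List.Relation.Binary.Permutation.Propositional.Properties
  using (shift; ∈-resp-↭)
open import Data.List.Relation.Binary.Subset.Propositional using (_⊆_)
open import Data.List.Relation.Binary.Subset.Propositional.Properties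
  using (⊆-refl; ⊆-trans; ∷⁺ʳ; ∈-∷⁺ʳ; ++⁺; ++⁺ʳ; filter-⊆; filter⁺′)
import Data.List.Relation.Binary.Subset.DecPropositional as DecSubset
open import Data.List.Relation.Unary.All as All using (All; []; _∷_)
open import Data.List.Relation.Unary.All.Properties using (¬All⇒Any¬)
open import Data.List.Relation.Unary.Any as Any using (Any; here; there; any?)
import Data.List.Relation.Unary.Any.Properties as Any
open import Data.Maybe.Base using (Maybe; just; nothing)
import Data.Maybe.Relation.Unary.Any as MAny
import Data.Maybe.Relation.Unary.All as MAll
open import Data.Nat.Base using (ℕ; zero; suc; _+_; _≤_; _<_; z≤n; s≤s; _≡ᵇ_)
import Data.Nat.Properties as ℕ
open import Data.Product.Base using (_×_; _,_; proj₁; proj₂; ∃-syntax; ∃₂)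
open import Data.Sum.Base as Sum using (_⊎_; inj₁; inj₂)
import Data.Sum.Properties as Sum
open import Data.Unit.Base using (⊤; tt)
open import Function.Base using (_∘_; id; case_of_)
open import Function.Bundles using (_↣_; mk↣)
open import Level using (0ℓ)
open import Relation.Binary.Core using (Rel; _⇔_)
open import Relation.Binary.Definitions using (DecidableEquality)
open import Relation.Binary.PropositionalEquality
  using (_≡_; refl; sym; trans; cong; subst; isEquivalence)
open import Relation.Nullary using (¬_; Dec; yes; no)
open import Relation.Nullary.Decidable
  using (_×-dec_; _⊎-dec_; ¬?; via-injection; decidable-stable)
open import Defs

private variable
  Var : Set
  φ χ ψ α γ : Formula Var
  Γ Δ : List (Formula Var)

-- Decidable equality of formulas

-- Postfix notation is injective because a stack machine reads it back; this
-- reduces equality of formulas to equality of lists of tokens.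

Token : Set → Set
Token Var = Var ⊎ Fin 6

postfix : Formula Var → List (Token Var) → List (Token Var)
postfix (var p) k = inj₁ p ∷ k
postfix (∼ φ)   k = postfix φ (inj₂ 0F ∷ k)
postfix (φ ∧ χ) k = postfix φ (postfix χ (inj₂ 1F ∷ k))
postfix (φ ∨ χ) k = postfix φ (postfix χ (inj₂ 2F ∷ k))
postfix (φ ⊃ χ) k = postfix φ (postfix χ (inj₂ 3F ∷ k))
postfix (□ φ)   k = postfix φ (inj₂ 4F ∷ k)
postfix (◇ φ)   k = postfix φ (inj₂ 5F ∷ k)

run : List (Token Var) → List (Formula Var) → List (Formula Var)
run (inj₁ p  ∷ k) s           = run k (var p ∷ s)
run (inj₂ 0F ∷ k) (φ ∷ s)     = run k (∼ φ ∷ s)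
run (inj₂ 1F ∷ k) (χ ∷ φ ∷ s) = run k (φ ∧ χ ∷ s)
run (inj₂ 2F ∷ k) (χ ∷ φ ∷ s) = run k (φ ∨ χ ∷ s)
run (inj₂ 3F ∷ k) (χ ∷ φ ∷ s) = run k (φ ⊃ χ ∷ s)
run (inj₂ 4F ∷ k) (φ ∷ s)     = run k (□ φ ∷ s)
run (inj₂ 5F ∷ k) (φ ∷ s)     = run k (◇ φ ∷ s)
-- Reached when the tokens run out; stuck inputs also end here, and `postfix` never produces one.
run _             s           = s

-- Generalising over the remaining input and the stack lets the two arguments of a connective be
-- read one after the other.
run-postfix : ∀ (φ : Formula Var) k s → run (postfix φ k) s ≡ run k (φ ∷ s)
run-postfix (var p) k s = refl
run-postfix (∼ φ)   k s = run-postfix φ _ s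
run-postfix (φ ∧ χ) k s = trans (run-postfix φ _ s) (run-postfix χ _ _)
run-postfix (φ ∨ χ) k s = trans (run-postfix φ _ s) (run-postfix χ _ _)
run-postfix (φ ⊃ χ) k s = trans (run-postfix φ _ s) (run-postfix χ _ _)
run-postfix (□ φ)   k s = run-postfix φ _ s
run-postfix (◇ φ)   k s = run-postfix φ _ s

postfix-injective : postfix φ [] ≡ postfix χ [] → φ ≡ χ
postfix-injective {φ = φ} {χ} eq = List.∷-injectiveˡ
  (trans (sym (run-postfix φ [] [])) (trans (cong (λ k → run k []) eq) (run-postfix χ [] [])))

formula-≟ : DecidableEquality Var → DecidableEquality (Formula Var)
formula-≟ _≟_ =
  via-injection (mk↣ postfix-injective) (List.≡-dec (Sum.≡-dec _≟_ Fin._≟_))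

-- Shapes, modalities and unboxed contexts

data Modality : Set where
  □⁺ □⁻ ◇⁺ ◇⁻ : Modality

-- Up to provable equivalence, a formula of shape `compound c cs` is the
-- disjunction of the conjunctions of the clauses c ∷ cs; a `necessity`
-- quantifies universally and a `possibility` existentially over the
-- relation of its modality.
data Shape (Var : Set) : Set where
  literal               : Shape Var
  implication           : Formula Var → Formula Var → Shape Var
  compound              : List (Formula Var) → List (List (Formula Var)) → Shape Var
  necessity possibility : Modality → Formula Var → Shape Var

shape : Formula Var → Shape Var
shape (var p)     = literal
shape (φ ∧ χ)     = compound (φ ∷ χ ∷ []) []
shape (φ ∨ χ)     = compound [ φ ] [ [ χ ] ]
shape (φ ⊃ χ)     = implication φ χ
shape (□ φ)       = necessity □⁺ φ
shape (◇ φ)       = possibility ◇⁺ φ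
shape (∼ var p)   = literal
shape (∼ ∼ φ)     = compound [ φ ] []
shape (∼ (φ ∧ χ)) = compound [ ∼ φ ] [ [ ∼ χ ] ]
shape (∼ (φ ∨ χ)) = compound (∼ φ ∷ ∼ χ ∷ []) []
shape (∼ (φ ⊃ χ)) = compound (φ ∷ ∼ χ ∷ []) []
shape (∼ □ φ)     = possibility □⁻ (∼ φ)
shape (∼ ◇ φ)     = necessity ◇⁻ (∼ φ)

-- Two modalities have the same index iff frames of L interpret them by the
-- same relation.
index : Logic → Modality → ℕ
index CN4K □⁺ = 0
index CN4K □⁻ = 1
index CN4K ◇⁺ = 2
index CN4K ◇⁻ = 3
index CN4K± □⁺ = 0
index CN4K± □⁻ = 1
index CN4K± ◇⁺ = 0
index CN4K± ◇⁻ = 1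
index CN4K⋎ □⁺ = 0
index CN4K⋎ □⁻ = 0
index CN4K⋎ ◇⁺ = 1
index CN4K⋎ ◇⁻ = 1
index CN4K⋈ □⁺ = 0
index CN4K⋈ □⁻ = 1
index CN4K⋈ ◇⁺ = 1
index CN4K⋈ ◇⁻ = 0
index CN4K¹ _ = 0

-- Separate clauses avoid concatenation with an empty list: for a concrete logic and modality the
-- result is definitionally the antecedent used by the modal rule.
select : Bool → Bool → List (Formula Var) → List (Formula Var)
select false false Γ = []
select false true  Γ = Γ ^∼◇
select true  false Γ = Γ ^□
select true  true  Γ = Γ ^□ ++ Γ ^∼◇

-- What the necessities in Γ say about successors along the relation of index i.
content : Logic → ℕ → List (Formula Var) → List (Formula Var)
content L i = select (index L □⁺ ≡ᵇ i) (index L ◇⁻ ≡ᵇ i)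

unboxed : Logic → Modality → List (Formula Var) → List (Formula Var)
unboxed L m = content L (index L m)

∈-mapMaybe⁺ : ∀ {A B : Set} (f : A → Maybe B) {x y xs} → x ∈ xs → f x ≡ just y → y ∈ mapMaybe f xs
∈-mapMaybe⁺ f x∈ eq = Any.mapMaybe⁺ f _
  (Any.map⁺ (Any.map (λ { refl → subst (MAny.Any _) (sym eq) (MAny.just refl) }) x∈))

∈-mapMaybe⁻ : ∀ {A B : Set} (f : A → Maybe B) {y} xs → y ∈ mapMaybe f xs → ∃[ x ] (x ∈ xs × f x ≡ just y)
∈-mapMaybe⁻ f (x ∷ xs) y∈ with f x in eq | y∈
... | just _  | here refl = x , here refl , eq
... | just _  | there y∈′ = let x′ , x′∈ , eq′ = ∈-mapMaybe⁻ f xs y∈′ in x′ , there x′∈ , eq′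
... | nothing | y∈′       = let x′ , x′∈ , eq′ = ∈-mapMaybe⁻ f xs y∈′ in x′ , there x′∈ , eq′

mapMaybe-⊆ : ∀ {A B : Set} (f : A → Maybe B) {xs ys} → xs ⊆ ys → mapMaybe f xs ⊆ mapMaybe f ys
mapMaybe-⊆ f {xs} xs⊆ys y∈ = let _ , x∈ , eq = ∈-mapMaybe⁻ f xs y∈ in ∈-mapMaybe⁺ f (xs⊆ys x∈) eq

select-⊆ : ∀ b b′ → Γ ⊆ Δ → select b b′ Γ ⊆ select b b′ Δ
select-⊆ false false Γ⊆Δ = id
select-⊆ false true  Γ⊆Δ = mapMaybe-⊆ un∼◇ Γ⊆Δ
select-⊆ true  false Γ⊆Δ = mapMaybe-⊆ un□ Γ⊆Δ
select-⊆ true  true  Γ⊆Δ = ++⁺ (mapMaybe-⊆ un□ Γ⊆Δ) (mapMaybe-⊆ un∼◇ Γ⊆Δ)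

unboxed-⊆ : ∀ L m → Γ ⊆ Δ → unboxed L m Γ ⊆ unboxed L m Δ
unboxed-⊆ L m = select-⊆ (index L □⁺ ≡ᵇ index L m) (index L ◇⁻ ≡ᵇ index L m)

un□-shape : (α : Formula Var) → un□ α ≡ just γ → shape α ≡ necessity □⁺ γ
un□-shape (□ φ) refl = refl

un∼◇-shape : (α : Formula Var) → un∼◇ α ≡ just γ → shape α ≡ necessity ◇⁻ γ
un∼◇-shape (∼ ◇ φ) refl = refl

∈-^□⁻ : ∀ Γ → γ ∈ Γ ^□ → ∃₂ λ α m → α ∈ Γ × shape α ≡ necessity m γ
∈-^□⁻ Γ γ∈ =
  let α , α∈ , eq = ∈-mapMaybe⁻ un□ Γ γ∈ in α , □⁺ , α∈ , un□-shape α eq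

∈-^∼◇⁻ : ∀ Γ → γ ∈ Γ ^∼◇ → ∃₂ λ α m → α ∈ Γ × shape α ≡ necessity m γ
∈-^∼◇⁻ Γ γ∈ =
  let α , α∈ , eq = ∈-mapMaybe⁻ un∼◇ Γ γ∈ in α , ◇⁻ , α∈ , un∼◇-shape α eq

∈-select⁻ : ∀ Γ b b′ → γ ∈ select b b′ Γ → ∃₂ λ α m → α ∈ Γ × shape α ≡ necessity m γ
∈-select⁻ Γ false true  γ∈ = ∈-^∼◇⁻ Γ γ∈
∈-select⁻ Γ true  false γ∈ = ∈-^□⁻ Γ γ∈
∈-select⁻ Γ true  true  γ∈ = Sum.[ ∈-^□⁻ Γ , ∈-^∼◇⁻ Γ ] (∈-++⁻ (Γ ^□) γ∈)

≡ᵇ-refl : ∀ n → (n ≡ᵇ n) ≡ true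
≡ᵇ-refl zero    = refl
≡ᵇ-refl (suc n) = ≡ᵇ-refl n

-- Only `□ φ` and `∼ ◇ φ` are necessities, and each switches on its own flag of `select`, as an
-- index equals itself; the other flag can only add formulas.
∈-unboxed⁺ : ∀ L {m} → α ∈ Γ → shape α ≡ necessity m γ → γ ∈ unboxed L m Γ
∈-unboxed⁺ {α = □ φ} {Γ = Γ} L α∈ refl
  rewrite ≡ᵇ-refl (index L □⁺) with index L ◇⁻ ≡ᵇ index L □⁺
... | false = ∈-mapMaybe⁺ un□ α∈ refl
... | true  = ∈-++⁺ˡ (∈-mapMaybe⁺ un□ α∈ refl)
∈-unboxed⁺ {α = ∼ ◇ φ} {Γ = Γ} L α∈ refl
  rewrite ≡ᵇ-refl (index L ◇⁻) with index L □⁺ ≡ᵇ index L ◇⁻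
... | false = ∈-mapMaybe⁺ un∼◇ α∈ refl
... | true  = ∈-++⁺ʳ (Γ ^□) (∈-mapMaybe⁺ un∼◇ α∈ refl)


-- Sizes, weights and pieces

size : Formula Var → ℕ
size (var p) = 1
size (∼ φ)   = suc (size φ)
-- Each argument of a binary connective counts one extra: otherwise `∼ φ ∷ ∼ χ ∷ []` would weigh as
-- much as `∼ (φ ∨ χ)`, which it replaces.
size (φ ∧ χ) = suc (suc (size φ) + suc (size χ))
size (φ ∨ χ) = suc (suc (size φ) + suc (size χ))
size (φ ⊃ χ) = suc (suc (size φ) + suc (size χ))
size (□ φ)   = suc (size φ)
size (◇ φ)   = suc (size φ)

weight : List (Formula Var) → ℕ
weight Γ = sum (map size Γ)

weight-++ : ∀ (Γ Δ : List (Formula Var)) → weight (Γ ++ Δ) ≡ weight Γ + weight Δ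
weight-++ Γ Δ = trans (cong sum (map-++ size Γ Δ)) (sum-++ (map size Γ) (map size Δ))

∈-weight : γ ∈ Γ → size γ ≤ weight Γ
∈-weight (here refl) = ℕ.m≤m+n _ _
∈-weight (there γ∈)  = ℕ.≤-trans (∈-weight γ∈) (ℕ.m≤n+m _ _)

-- The immediate subformulas for closure, saturation and the truth lemma. They are grouped into
-- lists because saturation replaces a formula by a whole clause, whose total weight must be
-- smaller.
pieces : Shape Var → List (List (Formula Var))
pieces literal           = []
pieces (implication φ χ) = [ φ ] ∷ [ χ ] ∷ []
pieces (compound c cs)   = c ∷ cs
pieces (necessity m φ)   = [ [ φ ] ]
pieces (possibility m φ) = [ [ φ ] ]

pieces-weight : (α : Formula Var) → All (λ c → weight c < size α) (pieces (shape α))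
pieces-weight α = go α
  where
  left : ∀ {a} b → a < suc (suc a + suc b)
  left b = s≤s (ℕ.≤-trans (ℕ.n≤1+n _) (ℕ.m≤m+n _ (suc b)))

  right : ∀ a {b} → b < suc (suc a + suc b)
  right a = s≤s (ℕ.≤-trans (ℕ.n≤1+n _) (ℕ.m≤n+m _ (suc a)))

  one : ∀ (φ : Formula Var) {n} → size φ < n → weight [ φ ] < n
  one φ = subst (_< _) (sym (ℕ.+-identityʳ (size φ)))

  two : ∀ (φ χ : Formula Var) {n m} → size φ ≤ suc n → size χ ≤ suc m →
        weight (φ ∷ χ ∷ []) < suc (suc n + suc m)
  two φ χ φ≤ χ≤ = s≤s (ℕ.+-mono-≤ φ≤ (subst (_≤ _) (sym (ℕ.+-identityʳ (size χ))) χ≤))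

  go : ∀ (α : Formula Var) → All (λ c → weight c < size α) (pieces (shape α))
  go (var p)     = []
  go (φ ∧ χ)     = two φ χ (ℕ.n≤1+n _) (ℕ.n≤1+n _) ∷ []
  go (φ ∨ χ)     = one φ (left _) ∷ one χ (right (size φ)) ∷ []
  go (φ ⊃ χ)     = one φ (left _) ∷ one χ (right (size φ)) ∷ []
  go (□ φ)       = one φ ℕ.≤-refl ∷ []
  go (◇ φ)       = one φ ℕ.≤-refl ∷ []
  go (∼ var p)   = []
  go (∼ ∼ φ)     = one φ (ℕ.n≤1+n _) ∷ []
  go (∼ (φ ∧ χ)) = one (∼ φ) (s≤s (left _)) ∷ one (∼ χ) (s≤s (right (size φ))) ∷ []
  go (∼ (φ ∨ χ)) = ℕ.m≤n⇒m≤1+n (two (∼ φ) (∼ χ) ℕ.≤-refl ℕ.≤-refl) ∷ []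
  go (∼ (φ ⊃ χ)) = ℕ.m≤n⇒m≤1+n (two φ (∼ χ) (ℕ.n≤1+n _) ℕ.≤-refl) ∷ []
  go (∼ □ φ)     = one (∼ φ) ℕ.≤-refl ∷ []
  go (∼ ◇ φ)     = one (∼ φ) ℕ.≤-refl ∷ []

piece-size : ∀ (α : Formula Var) {c} → c ∈ pieces (shape α) → γ ∈ c → size γ < size α
piece-size α c∈ γ∈ = ℕ.≤-<-trans (∈-weight γ∈) (All.lookup (pieces-weight α) c∈)

-- Finite sets closed under subformulas

mutual
  -- Every subformula enters with its negation, since the pieces of `∼ φ` may be negations of parts
  -- of `φ`.
  closure : Formula Var → List (Formula Var)
  closure φ = φ ∷ ∼ φ ∷ closure-below φ

  closure-below : Formula Var → List (Formula Var)
  closure-below (var p) = []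
  closure-below (∼ φ)   = closure φ
  closure-below (φ ∧ χ) = closure φ ++ closure χ
  closure-below (φ ∨ χ) = closure φ ++ closure χ
  closure-below (φ ⊃ χ) = closure φ ++ closure χ
  closure-below (□ φ)   = closure φ
  closure-below (◇ φ)   = closure φ

Closed : List (Formula Var) → Set
Closed S = ∀ {α c} → α ∈ S → c ∈ pieces (shape α) → c ⊆ S

below : closure-below φ ⊆ closure φ
below = there ∘ there

belowˡ : closure-below φ ≡ closure χ ++ Γ → closure χ ⊆ closure φ
belowˡ eq = below ∘ subst (_ ∈_) (sym eq) ∘ ∈-++⁺ˡ

belowʳ : closure-below φ ≡ closure χ ++ Γ → Γ ⊆ closure φ
belowʳ {χ = χ} eq = below ∘ subst (_ ∈_) (sym eq) ∘ ∈-++⁺ʳ (closure χ)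

∼-pieces : (φ : Formula Var) → All (All (_∈ closure φ)) (pieces (shape (∼ φ)))
∼-pieces φ@(var p) = []
∼-pieces φ@(∼ ψ)   = (below {φ = φ} (here refl) ∷ []) ∷ []
∼-pieces φ@(ψ ∧ χ) =
  (belowˡ {φ = φ} refl (there (here refl)) ∷ []) ∷ (belowʳ {φ = φ} {ψ} refl (there (here refl)) ∷ []) ∷ []
∼-pieces φ@(ψ ∨ χ) =
  (belowˡ {φ = φ} refl (there (here refl)) ∷ belowʳ {φ = φ} {ψ} refl (there (here refl)) ∷ []) ∷ []
∼-pieces φ@(ψ ⊃ χ) =
  (belowˡ {φ = φ} refl (here refl) ∷ belowʳ {φ = φ} {ψ} refl (there (here refl)) ∷ []) ∷ []
∼-pieces φ@(□ ψ)   = (below {φ = φ} (there (here refl)) ∷ []) ∷ []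
∼-pieces φ@(◇ ψ)   = (below {φ = φ} (there (here refl)) ∷ []) ∷ []

closure-pieces : (φ : Formula Var) → All (All (_∈ closure φ)) (pieces (shape φ))
closure-pieces φ@(var p) = []
closure-pieces φ@(∼ ψ)   = All.map (All.map (below {φ = φ})) (∼-pieces ψ)
closure-pieces φ@(ψ ∧ χ) =
  (belowˡ {φ = φ} refl (here refl) ∷ belowʳ {φ = φ} {ψ} refl (here refl) ∷ []) ∷ []
closure-pieces φ@(ψ ∨ χ) =
  (belowˡ {φ = φ} refl (here refl) ∷ []) ∷ (belowʳ {φ = φ} {ψ} refl (here refl) ∷ []) ∷ []
closure-pieces φ@(ψ ⊃ χ) =
  (belowˡ {φ = φ} refl (here refl) ∷ []) ∷ (belowʳ {φ = φ} {ψ} refl (here refl) ∷ []) ∷ []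
closure-pieces φ@(□ ψ)   = (below {φ = φ} (here refl) ∷ []) ∷ []
closure-pieces φ@(◇ ψ)   = (below {φ = φ} (here refl) ∷ []) ∷ []

++-closed : Closed Γ → Closed Δ → Closed (Γ ++ Δ)
++-closed {Γ = Γ} Γ-closed Δ-closed α∈ c∈ γ∈ with ∈-++⁻ Γ α∈
... | inj₁ α∈Γ = ∈-++⁺ˡ (Γ-closed α∈Γ c∈ γ∈)
... | inj₂ α∈Δ = ∈-++⁺ʳ Γ (Δ-closed α∈Δ c∈ γ∈)

mutual
  closure-closed : (φ : Formula Var) → Closed (closure φ)
  closure-closed φ (here refl)         c∈ γ∈ = All.lookup (All.lookup (closure-pieces φ) c∈) γ∈
  closure-closed φ (there (here refl)) c∈ γ∈ = All.lookup (All.lookup (∼-pieces φ) c∈) γ∈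
  closure-closed φ (there (there α∈))  c∈ γ∈ = below {φ = φ} (closure-below-closed φ α∈ c∈ γ∈)

  closure-below-closed : (φ : Formula Var) → Closed (closure-below φ)
  closure-below-closed (∼ φ)   = closure-closed φ
  closure-below-closed (φ ∧ χ) = ++-closed (closure-closed φ) (closure-closed χ)
  closure-below-closed (φ ∨ χ) = ++-closed (closure-closed φ) (closure-closed χ)
  closure-below-closed (φ ⊃ χ) = ++-closed (closure-closed φ) (closure-closed χ)
  closure-below-closed (□ φ)   = closure-closed φ
  closure-below-closed (◇ φ)   = closure-closed φ

concatMap-closure-closed : (Γ : List (Formula Var)) → Closed (concatMap closure Γ)
concatMap-closure-closed (φ ∷ Γ) = ++-closed (closure-closed φ) (concatMap-closure-closed Γ)

⊆-concatMap-closure : (Γ : List (Formula Var)) → Γ ⊆ concatMap closure Γ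
⊆-concatMap-closure (φ ∷ Γ) (here refl) = here refl
⊆-concatMap-closure (φ ∷ Γ) (there γ∈)  = ∈-++⁺ʳ (closure φ) (⊆-concatMap-closure Γ γ∈)

-- Modal rules and frame conditions, uniformly in the logic

necessity-rule : ∀ L {ψ : Formula Var} {m χ Δ} → shape ψ ≡ necessity m χ →
                 L ⊢ (unboxed L m Δ ⇒ χ) → L ⊢ (Δ ⇒ ψ)
necessity-rule L {□ χ} refl d = go L d
  where
  go : ∀ L {Δ} → L ⊢ (unboxed L □⁺ Δ ⇒ χ) → L ⊢ (Δ ⇒ □ χ)
  -- In each logic `unboxed` computes to the antecedent of the rule's premise; the cases only locate
  -- the rule in `modalRules`.
  go CN4K  d = by (inj₂ (_ , here refl , □r))  ↭-refl (d ∷ [])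
  go CN4K± d = by (inj₂ (_ , here refl , □r))  ↭-refl (d ∷ [])
  go CN4K⋎ d = by (inj₂ (_ , here refl , □r))  ↭-refl (d ∷ [])
  go CN4K⋈ d = by (inj₂ (_ , here refl , □⋈r)) ↭-refl (d ∷ [])
  go CN4K¹ d = by (inj₂ (_ , here refl , □⋈r)) ↭-refl (d ∷ [])
necessity-rule L {∼ ◇ χ} refl d = go L d
  where
  go : ∀ L {Δ} → L ⊢ (unboxed L ◇⁻ Δ ⇒ ∼ χ) → L ⊢ (Δ ⇒ ∼ ◇ χ)
  go CN4K  d = by (inj₂ (_ , there (there (there (here refl))) , ◇∼r)) ↭-refl (d ∷ [])
  go CN4K± d = by (inj₂ (_ , there (there (there (here refl))) , ◇∼r)) ↭-refl (d ∷ [])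
  go CN4K⋎ d = by (inj₂ (_ , there (there (there (here refl))) , ◇∼r)) ↭-refl (d ∷ [])
  go CN4K⋈ d = by (inj₂ (_ , there (there (there (there (there (here refl))))) , ◇∼⋈r)) ↭-refl (d ∷ [])
  go CN4K¹ d = by (inj₂ (_ , there (there (there (there (there (here refl))))) , ◇∼⋈r)) ↭-refl (d ∷ [])

-- The principal formula may stay under `unboxed`, to which a possibility contributes nothing. A `◇`
-- and a `∼ □` share an index only in `CN4K⋈` and `CN4K¹`, whose calculi have the rules that relate
-- the two.
possibility-rule : ∀ L (α ψ : Formula Var) {m m′ φ χ Γ Δ} →
                   shape α ≡ possibility m′ φ → shape ψ ≡ possibility m χ → index L m′ ≡ index L m →
                   Γ ↭ α ∷ Δ → L ⊢ (φ ∷ unboxed L m (α ∷ Δ) ⇒ χ) → L ⊢ (Γ ⇒ ψ)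
possibility-rule CN4K  (◇ φ)   (◇ χ)   refl refl refl Γ↭ d =
  by (inj₂ (_ , there (here refl) , ◇r)) Γ↭ (d ∷ [])
possibility-rule CN4K  (∼ □ φ) (∼ □ χ) refl refl refl Γ↭ d =
  by (inj₂ (_ , there (there (here refl)) , □∼r)) Γ↭ (d ∷ [])
possibility-rule CN4K± (◇ φ)   (◇ χ)   refl refl refl Γ↭ d =
  by (inj₂ (_ , there (here refl) , ◇±r)) Γ↭ (d ∷ [])
possibility-rule CN4K± (∼ □ φ) (∼ □ χ) refl refl refl Γ↭ d =
  by (inj₂ (_ , there (there (here refl)) , □∼±r)) Γ↭ (d ∷ [])
possibility-rule CN4K⋎ (◇ φ)   (◇ χ)   refl refl refl Γ↭ d =
  by (inj₂ (_ , there (here refl) , ◇⋎r)) Γ↭ (d ∷ [])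
possibility-rule CN4K⋎ (∼ □ φ) (∼ □ χ) refl refl refl Γ↭ d =
  by (inj₂ (_ , there (there (here refl)) , □∼⋎r)) Γ↭ (d ∷ [])
possibility-rule CN4K⋈ (◇ φ)   (◇ χ)   refl refl refl Γ↭ d =
  by (inj₂ (_ , there (here refl) , ◇r)) Γ↭ (d ∷ [])
possibility-rule CN4K⋈ (∼ □ φ) (◇ χ)   refl refl refl Γ↭ d =
  by (inj₂ (_ , there (there (here refl)) , ◇⋈r)) Γ↭ (d ∷ [])
possibility-rule CN4K⋈ (∼ □ φ) (∼ □ χ) refl refl refl Γ↭ d =
  by (inj₂ (_ , there (there (there (here refl))) , □∼r)) Γ↭ (d ∷ [])
possibility-rule CN4K⋈ (◇ φ)   (∼ □ χ) refl refl refl Γ↭ d =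
  by (inj₂ (_ , there (there (there (there (here refl)))) , □∼⋈r)) Γ↭ (d ∷ [])
possibility-rule CN4K¹ (◇ φ)   (◇ χ)   refl refl refl Γ↭ d =
  by (inj₂ (_ , there (here refl) , ◇¹r)) Γ↭ (d ∷ [])
possibility-rule CN4K¹ (∼ □ φ) (◇ χ)   refl refl refl Γ↭ d =
  by (inj₂ (_ , there (there (here refl)) , ◇¹⋈r)) Γ↭ (d ∷ [])
possibility-rule CN4K¹ (∼ □ φ) (∼ □ χ) refl refl refl Γ↭ d =
  by (inj₂ (_ , there (there (there (here refl))) , □∼¹r)) Γ↭ (d ∷ [])
possibility-rule CN4K¹ (◇ φ)   (∼ □ χ) refl refl refl Γ↭ d =
  by (inj₂ (_ , there (there (there (there (here refl)))) , □∼¹⋈r)) Γ↭ (d ∷ [])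
possibility-rule CN4K  (∼ □ _) (◇ _) refl refl ()
possibility-rule CN4K  (◇ _) (∼ □ _) refl refl ()
possibility-rule CN4K± (∼ □ _) (◇ _) refl refl ()
possibility-rule CN4K± (◇ _) (∼ □ _) refl refl ()
possibility-rule CN4K⋎ (∼ □ _) (◇ _) refl refl ()
possibility-rule CN4K⋎ (◇ _) (∼ □ _) refl refl ()

relation : (F : Frame) → Modality → Rel (Frame.W F) 0ℓ
relation F □⁺ = Frame.R□⁺ F
relation F □⁻ = Frame.R□⁻ F
relation F ◇⁺ = Frame.R◇⁺ F
relation F ◇⁻ = Frame.R◇⁻ F

frameOf : ∀ L F → (∀ m m′ → index L m ≡ index L m′ → relation F m ⇔ relation F m′) → FrameOf L F
frameOf CN4K  F h = tt
frameOf CN4K± F h = h □⁺ ◇⁺ refl , h □⁻ ◇⁻ refl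
frameOf CN4K⋎ F h = h □⁺ □⁻ refl , h ◇⁺ ◇⁻ refl
frameOf CN4K⋈ F h = h □⁺ ◇⁻ refl , h ◇⁺ □⁻ refl
frameOf CN4K¹ F h = h □⁺ □⁻ refl , h □⁻ ◇⁺ refl , h ◇⁺ ◇⁻ refl

-- Backward steps of proof search

module Calculus {Var : Set} (L : Logic) (_≟_ : DecidableEquality (Formula Var)) where

  open DecMembership _≟_ using (_∈?_)
  open DecSubset _≟_ using (_⊆?_)

  private
    Fm Context : Set
    Fm = Formula Var
    Context = List Fm

  infixl 6 _∖_

  -- Removing every copy, and not just one, makes the operation monotone for `⊆`.
  _∖_ : Context → Fm → Context
  Γ ∖ α = filter (λ γ → ¬? (γ ≟ α)) Γ

  ∈-∖ : ∀ {γ} Γ α → γ ∈ Γ → γ ≡ α ⊎ γ ∈ Γ ∖ α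
  ∈-∖ {γ} Γ α γ∈ with γ ≟ α
  ... | yes γ≡α = inj₁ γ≡α
  ... | no  γ≢α = inj₂ (∈-filter⁺ _ γ∈ γ≢α)

  ∖-⊆ : ∀ Γ {Δ} α → Γ ⊆ Δ → Γ ∖ α ⊆ Δ ∖ α
  ∖-⊆ Γ α = filter⁺′ _ _ id

  ∖-weight : ∀ Γ α → weight (Γ ∖ α) ≤ weight Γ
  ∖-weight []      α = z≤n
  ∖-weight (γ ∷ Γ) α with γ ≟ α
  ... | yes _ = ℕ.≤-trans (∖-weight Γ α) (ℕ.m≤n+m _ (size γ))
  ... | no  _ = ℕ.+-monoʳ-≤ (size γ) (∖-weight Γ α)

  ∈-∖-weight : ∀ {Γ α} → α ∈ Γ → size α + weight (Γ ∖ α) ≤ weight Γ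
  ∈-∖-weight {γ ∷ Γ} {α} α∈ with γ ≟ α | α∈
  ... | yes refl | _         = ℕ.+-monoʳ-≤ (size α) (∖-weight Γ α)
  ... | no γ≢α   | here α≡γ  = ⊥-elim (γ≢α (sym α≡γ))
  ... | no _     | there α∈Γ =
    ℕ.≤-trans (ℕ.≤-reflexive (x∙yz≈y∙xz ℕ.+-commutativeSemigroup (size α) (size γ) _))
      (ℕ.+-monoʳ-≤ (size γ) (∈-∖-weight α∈Γ))

  replace-weight : ∀ {Γ α} c → α ∈ Γ → weight c < size α → weight (c ++ Γ ∖ α) < weight Γ
  replace-weight {Γ} {α} c α∈Γ c<α =
    subst (_< weight Γ) (sym (weight-++ c (Γ ∖ α)))
      (ℕ.<-≤-trans (ℕ.+-monoˡ-< (weight (Γ ∖ α)) c<α) (∈-∖-weight α∈Γ))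

  -- One backward step of proof search, where Q tells which sequents are
  -- already derived. Contexts are read as sets.
  module _ (Q : Context → Fm → Set) where

    Diamond : Context → Modality → Fm → Shape Var → Set
    Diamond Γ m χ (possibility m′ φ) = index L m′ ≡ index L m × Q (φ ∷ unboxed L m Γ) χ
    Diamond Γ m χ _                  = ⊥

    Right : Context → Fm → Shape Var → Set
    Right Γ ψ literal           = ψ ∈ Γ
    Right Γ ψ (implication φ χ) = Q (φ ∷ Γ) χ
    Right Γ ψ (compound c cs)   = Any (All (Q Γ)) (c ∷ cs)
    Right Γ ψ (necessity m χ)   = Q (unboxed L m Γ) χ
    Right Γ ψ (possibility m χ) = Any (Diamond Γ m χ ∘ shape) Γ

    -- G stands for derivability of the succedent, which may be absent.
    Left : (Context → Set) → Context → Fm → Shape Var → Set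
    Left G Γ α (implication φ χ) = Q Γ φ × G (χ ∷ Γ ∖ α)
    Left G Γ α (compound c cs)   = All (λ c′ → G (c′ ++ Γ ∖ α)) (c ∷ cs)
    Left G Γ α _                 = ⊥

    Step : Context → Fm → Set
    Step Γ ψ = Right Γ ψ (shape ψ) ⊎ Any (λ α → Left (λ Δ → Q Δ ψ) Γ α (shape α)) Γ

  module _ {Q : Context → Fm → Set} (Q? : ∀ Γ φ → Dec (Q Γ φ)) where

    diamond? : ∀ Γ m χ s → Dec (Diamond Q Γ m χ s)
    diamond? Γ m χ literal            = no λ ()
    diamond? Γ m χ (implication _ _)  = no λ ()
    diamond? Γ m χ (compound _ _)     = no λ ()
    diamond? Γ m χ (necessity _ _)    = no λ ()
    diamond? Γ m χ (possibility m′ φ) = (index L m′ ℕ.≟ index L m) ×-dec Q? _ χ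

    right? : ∀ Γ ψ s → Dec (Right Q Γ ψ s)
    right? Γ ψ literal           = ψ ∈? Γ
    right? Γ ψ (implication φ χ) = Q? _ χ
    right? Γ ψ (compound c cs)   = any? (All.all? (Q? Γ)) (c ∷ cs)
    right? Γ ψ (necessity m χ)   = Q? _ χ
    right? Γ ψ (possibility m χ) = any? (λ α → diamond? Γ m χ (shape α)) Γ

    left? : ∀ ψ Γ α s → Dec (Left Q (λ Δ → Q Δ ψ) Γ α s)
    left? ψ Γ α literal           = no λ ()
    left? ψ Γ α (implication φ χ) = Q? Γ φ ×-dec Q? _ ψ
    left? ψ Γ α (compound c cs)   = All.all? (λ c′ → Q? _ ψ) (c ∷ cs)
    left? ψ Γ α (necessity _ _)   = no λ ()
    left? ψ Γ α (possibility _ _) = no λ ()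

    step? : ∀ Γ ψ → Dec (Step Q Γ ψ)
    step? Γ ψ = right? Γ ψ (shape ψ) ⊎-dec any? (λ α → left? ψ Γ α (shape α)) Γ

  module _ {Q Q′ : Context → Fm → Set} (Q⇒Q′ : ∀ {Γ Δ φ} → Γ ⊆ Δ → Q Γ φ → Q′ Δ φ) where

    diamond-mono : ∀ {Γ Δ m χ} s → Γ ⊆ Δ → Diamond Q Γ m χ s → Diamond Q′ Δ m χ s
    diamond-mono {m = m} (possibility _ φ) Γ⊆Δ (eq , q) = eq , Q⇒Q′ (∷⁺ʳ φ (unboxed-⊆ L m Γ⊆Δ)) q

    right-mono : ∀ {Γ Δ ψ} s → Γ ⊆ Δ → Right Q Γ ψ s → Right Q′ Δ ψ s
    right-mono literal           Γ⊆Δ = Γ⊆Δ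
    right-mono (implication φ χ) Γ⊆Δ = Q⇒Q′ (∷⁺ʳ φ Γ⊆Δ)
    right-mono (compound c cs)   Γ⊆Δ = Any.map (All.map (Q⇒Q′ Γ⊆Δ))
    right-mono (necessity m χ)   Γ⊆Δ = Q⇒Q′ (unboxed-⊆ L m Γ⊆Δ)
    right-mono (possibility m χ) Γ⊆Δ r =
      let α , α∈ , d = find r in lose (Γ⊆Δ α∈) (diamond-mono (shape α) Γ⊆Δ d)

    left-mono : ∀ {Γ Δ ψ} α s → Γ ⊆ Δ →
                Left Q (λ Θ → Q Θ ψ) Γ α s → Left Q′ (λ Θ → Q′ Θ ψ) Δ α s
    left-mono {Γ} α (implication φ χ) Γ⊆Δ (q , q′) = Q⇒Q′ Γ⊆Δ q , Q⇒Q′ (∷⁺ʳ χ (∖-⊆ Γ α Γ⊆Δ)) q′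
    left-mono {Γ} α (compound c cs)   Γ⊆Δ = All.map (λ {c′} → Q⇒Q′ (++⁺ʳ c′ (∖-⊆ Γ α Γ⊆Δ)))

    -- Varying `Q` and the context together serves two purposes: turning steps on derived sequents
    -- into steps on provable ones, and moving between a context and its restriction to `S`.
    step-mono : ∀ {Γ Δ ψ} → Γ ⊆ Δ → Step Q Γ ψ → Step Q′ Δ ψ
    step-mono {ψ = ψ} Γ⊆Δ (inj₁ r) = inj₁ (right-mono (shape ψ) Γ⊆Δ r)
    step-mono Γ⊆Δ (inj₂ l) =
      let α , α∈ , q = find l in inj₂ (lose (Γ⊆Δ α∈) (left-mono α (shape α) Γ⊆Δ q))

  -- Soundness of the backward steps

  -- Quantifying over all larger antecedents builds weakening and contraction
  -- into the interpretation, so neither has to be proved admissible.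
  Provable : Context → Fm → Set
  Provable Γ φ = ∀ {Δ} → Γ ⊆ Δ → L ⊢ (Δ ⇒ φ)

  provable-mono : ∀ {Γ Δ φ} → Γ ⊆ Δ → Provable Γ φ → Provable Δ φ
  provable-mono Γ⊆Δ p Δ⊆Θ = p (⊆-trans Γ⊆Δ Δ⊆Θ)

  extract : ∀ {α : Fm} {Δ : Context} → α ∈ Δ → ∃[ Δ′ ] (Δ ↭ α ∷ Δ′)
  extract {α} α∈ with ys , zs , refl ← ∈-∃++ α∈ = ys ++ zs , shift α ys zs

  -- A rule of the calculus consumes one copy of `α` and may leave others in `Δ`; `Γ ∖ α` has none,
  -- so it embeds in either case.
  tail-⊆ : ∀ {Γ α Δ} → Γ ⊆ α ∷ Δ → Γ ∖ α ⊆ Δ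
  tail-⊆ {Γ} {α} Γ⊆ γ∈ with ∈-filter⁻ (λ γ → ¬? (γ ≟ α)) {xs = Γ} γ∈
  ... | γ∈Γ , γ≢α with Γ⊆ γ∈Γ
  ... | here γ≡α  = ⊥-elim (γ≢α γ≡α)
  ... | there γ∈Δ = γ∈Δ

  left-sound : ∀ {Γ ψ α} → α ∈ Γ → Left Provable (λ Δ → Provable Δ ψ) Γ α (shape α) → Provable Γ ψ
  left-sound {Γ} {ψ} {α} α∈ l {Δ} Γ⊆Δ with Δ′ , Δ↭ ← extract (Γ⊆Δ α∈) = go α Δ↭ Γ⊆ (tail-⊆ Γ⊆) l
    where
    Γ⊆ : Γ ⊆ α ∷ Δ′
    Γ⊆ = ∈-resp-↭ Δ↭ ∘ Γ⊆Δ

    go : ∀ α → Δ ↭ α ∷ Δ′ → Γ ⊆ α ∷ Δ′ → Γ ∖ α ⊆ Δ′ →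
         Left Provable (λ Θ → Provable Θ ψ) Γ α (shape α) → L ⊢ (Δ ⇒ ψ)
    go (φ ∧ χ)     Δ↭ Γ⊆ Γ∖⊆ (p ∷ [])     = by (inj₁ ∧l)  Δ↭ (p (++⁺ʳ (φ ∷ χ ∷ []) Γ∖⊆) ∷ [])
    go (φ ∨ χ)     Δ↭ Γ⊆ Γ∖⊆ (p ∷ q ∷ []) = by (inj₁ ∨l)  Δ↭ (p (∷⁺ʳ φ Γ∖⊆) ∷ q (∷⁺ʳ χ Γ∖⊆) ∷ [])
    -- The left premise of `⊃l` keeps the principal formula, hence `Γ⊆` there and `Γ∖⊆` only on the
    -- right.
    go (φ ⊃ χ)     Δ↭ Γ⊆ Γ∖⊆ (p , q)      = by (inj₁ ⊃l)  Δ↭ (p Γ⊆ ∷ q (∷⁺ʳ χ Γ∖⊆) ∷ [])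
    go (∼ ∼ φ)     Δ↭ Γ⊆ Γ∖⊆ (p ∷ [])     = by (inj₁ ∼∼l) Δ↭ (p (∷⁺ʳ φ Γ∖⊆) ∷ [])
    go (∼ (φ ∧ χ)) Δ↭ Γ⊆ Γ∖⊆ (p ∷ q ∷ []) = by (inj₁ ∼∧l) Δ↭ (p (∷⁺ʳ (∼ φ) Γ∖⊆) ∷ q (∷⁺ʳ (∼ χ) Γ∖⊆) ∷ [])
    go (∼ (φ ∨ χ)) Δ↭ Γ⊆ Γ∖⊆ (p ∷ [])     = by (inj₁ ∼∨l) Δ↭ (p (++⁺ʳ (∼ φ ∷ ∼ χ ∷ []) Γ∖⊆) ∷ [])
    go (∼ (φ ⊃ χ)) Δ↭ Γ⊆ Γ∖⊆ (p ∷ [])     = by (inj₁ ∼⊃l) Δ↭ (p (++⁺ʳ (φ ∷ ∼ χ ∷ []) Γ∖⊆) ∷ [])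

  necessity-sound : ∀ {Γ ψ m χ} → shape ψ ≡ necessity m χ → Provable (unboxed L m Γ) χ → Provable Γ ψ
  necessity-sound {m = m} eq p Γ⊆Δ = necessity-rule L eq (p (unboxed-⊆ L m Γ⊆Δ))

  possibility-sound : ∀ {Γ ψ m χ} → shape ψ ≡ possibility m χ →
                      Any (Diamond Provable Γ m χ ∘ shape) Γ → Provable Γ ψ
  possibility-sound {Γ} {ψ} {m} {χ} eq r {Δ} Γ⊆Δ with α , α∈ , d ← find r = go (shape α) refl d
    where
    go : ∀ s → shape α ≡ s → Diamond Provable Γ m χ s → L ⊢ (Δ ⇒ ψ)
    go (possibility m′ φ) eq′ (same , p) =
      let Δ′ , Δ↭ = extract (Γ⊆Δ α∈)
      in possibility-rule L α ψ eq′ eq same Δ↭ (p (∷⁺ʳ φ (unboxed-⊆ L m (∈-resp-↭ Δ↭ ∘ Γ⊆Δ))))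

  right-sound : ∀ {Γ} ψ → Right Provable Γ ψ (shape ψ) → Provable Γ ψ
  right-sound (var p) p∈ Γ⊆Δ = by (inj₁ ax) (proj₂ (extract (Γ⊆Δ p∈))) []
  right-sound (φ ∧ χ) (here (p ∷ q ∷ []))   Γ⊆Δ = by (inj₁ ∧r) ↭-refl (p Γ⊆Δ ∷ q Γ⊆Δ ∷ [])
  right-sound (φ ∨ χ) (here (p ∷ []))         Γ⊆Δ = by (inj₁ ∨r₁) ↭-refl (p Γ⊆Δ ∷ [])
  right-sound (φ ∨ χ) (there (here (p ∷ []))) Γ⊆Δ = by (inj₁ ∨r₂) ↭-refl (p Γ⊆Δ ∷ [])
  right-sound (φ ⊃ χ) p Γ⊆Δ = by (inj₁ ⊃r) ↭-refl (p (∷⁺ʳ φ Γ⊆Δ) ∷ [])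
  right-sound (□ φ) p = necessity-sound refl p
  right-sound (◇ φ) r = possibility-sound refl r
  right-sound (∼ var p) p∈ Γ⊆Δ = by (inj₁ ax∼) (proj₂ (extract (Γ⊆Δ p∈))) []
  right-sound (∼ ∼ φ) (here (p ∷ [])) Γ⊆Δ = by (inj₁ ∼∼r) ↭-refl (p Γ⊆Δ ∷ [])
  right-sound (∼ (φ ∧ χ)) (here (p ∷ []))         Γ⊆Δ = by (inj₁ ∼∧r₁) ↭-refl (p Γ⊆Δ ∷ [])
  right-sound (∼ (φ ∧ χ)) (there (here (p ∷ []))) Γ⊆Δ = by (inj₁ ∼∧r₂) ↭-refl (p Γ⊆Δ ∷ [])
  right-sound (∼ (φ ∨ χ)) (here (p ∷ q ∷ [])) Γ⊆Δ = by (inj₁ ∼∨r) ↭-refl (p Γ⊆Δ ∷ q Γ⊆Δ ∷ [])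
  right-sound (∼ (φ ⊃ χ)) (here (p ∷ q ∷ [])) Γ⊆Δ = by (inj₁ ∼⊃r) ↭-refl (p Γ⊆Δ ∷ q Γ⊆Δ ∷ [])
  right-sound (∼ □ φ) r = possibility-sound refl r
  right-sound (∼ ◇ φ) p = necessity-sound refl p

  step-sound : ∀ {Γ ψ} → Step Provable Γ ψ → Provable Γ ψ
  step-sound {ψ = ψ} (inj₁ r) = right-sound ψ r
  step-sound (inj₂ l) = let α , α∈ , q = find l in left-sound α∈ q

  -- Computing the least fixpoint

  subcontexts : Context → List Context
  subcontexts []      = [ [] ]
  subcontexts (α ∷ S) = subcontexts S ++ map (α ∷_) (subcontexts S)

  -- Picks a representative among finitely many contexts; for `Γ ⊆ S` it has the same members as
  -- `Γ`.
  restrict : Context → Context → Context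
  restrict S Γ = filter (_∈? Γ) S

  restrict-subcontext : ∀ S Γ → restrict S Γ ∈ subcontexts S
  restrict-subcontext []      Γ = here refl
  restrict-subcontext (α ∷ S) Γ with α ∈? Γ
  ... | yes _ = ∈-++⁺ʳ (subcontexts S) (∈-map⁺ (α ∷_) (restrict-subcontext S Γ))
  ... | no  _ = ∈-++⁺ˡ (restrict-subcontext S Γ)

  -- Matching the antecedent only up to `⊆` builds weakening into a finite table.
  Derived : List (Context × Fm) → Context → Fm → Set
  Derived D Γ φ = Any (λ (Δ , χ) → Δ ⊆ Γ × χ ≡ φ) D

  derived? : ∀ D Γ φ → Dec (Derived D Γ φ)
  derived? D Γ φ = any? (λ (Δ , χ) → (Δ ⊆? Γ) ×-dec (χ ≟ φ)) D

  derived-mono : ∀ {D Γ Δ φ} → Γ ⊆ Δ → Derived D Γ φ → Derived D Δ φ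
  derived-mono Γ⊆Δ = Any.map (λ (Θ⊆Γ , eq) → ⊆-trans Θ⊆Γ Γ⊆Δ , eq)

  Sound : List (Context × Fm) → Set
  Sound = All (λ (Γ , φ) → Provable Γ φ)

  derived-sound : ∀ {D Γ φ} → Sound D → Derived D Γ φ → Provable Γ φ
  derived-sound (p ∷ _)  (here (Δ⊆Γ , refl)) = provable-mono Δ⊆Γ p
  derived-sound (_ ∷ ps) (there d)           = derived-sound ps d

  -- `Y` holds the pairs still open. A round copies into `D` a pair of `Y` that has a step; being
  -- derived, it is then filtered out of `Y`, so `length Y` bounds the number of rounds. Soundness
  -- survives by `step-sound`.
  fixpoint : ∀ X → ∃[ D ] (Sound D × (∀ {Γ φ} → (Γ , φ) ∈ X → Step (Derived D) Γ φ → Derived D Γ φ))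
  fixpoint X = go (length X) X ℕ.≤-refl [] [] inj₁
    where
    Goal : Set
    Goal = ∃[ D ] (Sound D × (∀ {Γ φ} → (Γ , φ) ∈ X → Step (Derived D) Γ φ → Derived D Γ φ))

    go : ∀ n Y → length Y ≤ n → ∀ D → Sound D →
         (∀ {Γ φ} → (Γ , φ) ∈ X → (Γ , φ) ∈ Y ⊎ Derived D Γ φ) → Goal
    go n Y len D sound covers with any? (λ (Γ , φ) → step? (derived? D) Γ φ) Y
    -- No open pair has a step, so a pair of `X` with a step must already be derived.
    ... | no ¬step = D , sound , λ x∈ step → Sum.[ (λ y∈ → ⊥-elim (¬step (lose y∈ step))) , id ] (covers x∈)
    ... | yes steps with (Γ , φ) , y∈ , step ← find steps = next n len
      where
      D′ : List (Context × Fm)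
      D′ = (Γ , φ) ∷ D

      sound′ : Sound D′
      sound′ = step-sound (step-mono (λ Γ⊆Δ → provable-mono Γ⊆Δ ∘ derived-sound sound) ⊆-refl step) ∷ sound

      underived? : ∀ x → Dec (¬ Derived D′ (proj₁ x) (proj₂ x))
      underived? (Δ , χ) = ¬? (derived? D′ Δ χ)

      covers′ : ∀ {Δ χ} → (Δ , χ) ∈ X → (Δ , χ) ∈ filter underived? Y ⊎ Derived D′ Δ χ
      covers′ {Δ} {χ} x∈ with derived? D′ Δ χ | covers x∈
      ... | yes d | _        = inj₂ d
      ... | no ¬d | inj₁ y∈  = inj₁ (∈-filter⁺ underived? y∈ ¬d)
      ... | no ¬d | inj₂ d   = inj₂ (there d)

      shorter : length (filter underived? Y) < length Y
      shorter = filter-notAll underived? Y (lose y∈ (λ ¬d → ¬d (here (⊆-refl , refl))))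

      next : ∀ n → length Y ≤ n → Goal
      next zero    len = ⊥-elim (ℕ.n≮0 (ℕ.<-≤-trans shorter len))
      next (suc n) len = go n (filter underived? Y) (ℕ.≤-pred (ℕ.<-≤-trans shorter len)) D′ sound′ covers′

  -- Derivability over a closed set, and saturation

  module Canonical (S : Context) (S-closed : Closed S) where

    private
      base = fixpoint (cartesianProduct (subcontexts S) S)

    infix 4 _⊩ᴰ_ _⊢ᴰ_ _⊢ᴰ?_

    _⊢ᴰ_ : Context → Fm → Set
    _⊢ᴰ_ = Derived (proj₁ base)

    _⊢ᴰ?_ : ∀ Γ φ → Dec (Γ ⊢ᴰ φ)
    _⊢ᴰ?_ = derived? (proj₁ base)

    ⊢ᴰ-sound : ∀ {Γ φ} → Γ ⊢ᴰ φ → L ⊢ (Γ ⇒ φ)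
    ⊢ᴰ-sound d = derived-sound (proj₁ (proj₂ base)) d ⊆-refl

    -- The fixpoint covers only restricted contexts, so the step is transported to `restrict S Γ`
    -- and its conclusion weakened back to `Γ`.
    derive : ∀ {Γ φ} → Γ ⊆ S → φ ∈ S → Step _⊢ᴰ_ Γ φ → Γ ⊢ᴰ φ
    derive {Γ} Γ⊆S φ∈S step = derived-mono restrict⊆
      (proj₂ (proj₂ base) (∈-cartesianProduct⁺ (restrict-subcontext S Γ) φ∈S)
        (step-mono derived-mono ⊆restrict step))
      where
      restrict⊆ : restrict S Γ ⊆ Γ
      restrict⊆ γ∈ = proj₂ (∈-filter⁻ (_∈? Γ) {xs = S} γ∈)
      ⊆restrict : Γ ⊆ restrict S Γ
      ⊆restrict γ∈ = ∈-filter⁺ (_∈? Γ) (Γ⊆S γ∈) γ∈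

    -- An implication counts only once its antecedent is derivable, which settles the left premise
    -- of `⊃l`; until then a world may keep it.
    Reducible : Context → Shape Var → Set
    Reducible Γ (implication φ χ) = Γ ⊢ᴰ φ
    Reducible Γ (compound c cs)   = ⊤
    Reducible Γ _                 = ⊥

    reducible? : ∀ Γ s → Dec (Reducible Γ s)
    reducible? Γ literal           = no λ ()
    reducible? Γ (implication φ χ) = Γ ⊢ᴰ? φ
    reducible? Γ (compound c cs)   = yes tt
    reducible? Γ (necessity m φ)   = no λ ()
    reducible? Γ (possibility m φ) = no λ ()

    Irreducible : Context → Set
    Irreducible Γ = ∀ {α} → α ∈ Γ → ¬ Reducible Γ (shape α)

    -- Left rules discard their principal formula; a formula is represented
    -- by Γ if it could have been discarded on the way to Γ.
    data Represents (Γ : Context) (α : Fm) : Set where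
      member : α ∈ Γ → Represents Γ α
      modus  : ∀ {φ χ} → shape α ≡ implication φ χ → Represents Γ χ → Represents Γ α
      branch : ∀ {c cs c′} → shape α ≡ compound c cs → c′ ∈ c ∷ cs →
               (∀ {γ} → γ ∈ c′ → Represents Γ γ) → Represents Γ α

    represents-trans : ∀ {Γ Δ α} → (∀ {γ} → γ ∈ Γ → Represents Δ γ) → Represents Γ α → Represents Δ α
    represents-trans h (member α∈)      = h α∈
    represents-trans h (modus eq r)     = modus eq (represents-trans h r)
    represents-trans h (branch eq c∈ r) = branch eq c∈ (λ γ∈ → represents-trans h (r γ∈))

    replace-⊆ : ∀ {Γ α c} → Γ ⊆ S → α ∈ Γ → c ∈ pieces (shape α) → c ++ Γ ∖ α ⊆ S
    replace-⊆ {Γ} {α} {c} Γ⊆S α∈ c∈ γ∈ with ∈-++⁻ c γ∈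
    ... | inj₁ γ∈c = S-closed (Γ⊆S α∈) c∈ γ∈c
    ... | inj₂ γ∈Γ = Γ⊆S (filter-⊆ _ Γ γ∈Γ)

    replace-represents : ∀ {Γ α c Δ} → (∀ {γ} → γ ∈ c ++ Γ ∖ α → Represents Δ γ) →
                         Represents Δ α → ∀ {γ} → γ ∈ Γ → Represents Δ γ
    replace-represents {Γ} {α} {c} h r γ∈ with ∈-∖ Γ α γ∈
    ... | inj₁ refl = r
    ... | inj₂ γ∈′  = h (∈-++⁺ʳ c γ∈′)

    -- `G` is what must be kept from holding: derivability of a chosen formula, or the empty
    -- predicate when there is nothing to avoid.
    record Saturation (G : Context → Set) (Γ : Context) : Set where
      field
        result      : Context
        result⊆S    : result ⊆ S
        irreducible : Irreducible result
        avoids      : ¬ G result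
        represents  : ∀ {γ} → γ ∈ Γ → Represents result γ

    module _ (G : Context → Set) (G? : ∀ Γ → Dec (G Γ))
             (G-closed : ∀ {Γ α} → Γ ⊆ S → α ∈ Γ → Left _⊢ᴰ_ G Γ α (shape α) → G Γ) where

      private
        -- A reducible member is replaced by a clause that keeps `G` false. Since `G` is closed
        -- under left steps, it cannot hold on all branches, and its decidability finds a branch
        -- where it fails. The weight drops each time.
        saturate-below : ∀ n Γ → weight Γ < n → Γ ⊆ S → ¬ G Γ → Saturation G Γ
        saturate-below (suc n) Γ lt Γ⊆S ¬G with any? (reducible? Γ ∘ shape) Γ
        ... | no ¬red = record
          { result⊆S = Γ⊆S ; irreducible = λ α∈ red → ¬red (lose α∈ red)
          ; avoids = ¬G ; represents = member }
        ... | yes red with α , α∈ , ρ ← find red = reduce (shape α) refl ρ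
          where
          continue : ∀ c → c ∈ pieces (shape α) → ¬ G (c ++ Γ ∖ α) → Saturation G (c ++ Γ ∖ α)
          continue c c∈ = saturate-below n _
            (ℕ.<-≤-trans (replace-weight c α∈ (All.lookup (pieces-weight α) c∈)) (ℕ.≤-pred lt))
            (replace-⊆ Γ⊆S α∈ c∈)

          extend : ∀ c → (s : Saturation G (c ++ Γ ∖ α)) →
                   Represents (Saturation.result s) α → Saturation G Γ
          extend c s r = record
            { Saturation s ; represents = replace-represents {c = c} (Saturation.represents s) r }

          reduce : ∀ s → shape α ≡ s → Reducible Γ s → Saturation G Γ
          reduce (implication φ χ) eq ⊢φ =
            let s = continue [ χ ] (subst (λ s → [ χ ] ∈ pieces s) (sym eq) (there (here refl)))
                      (λ g → ¬G (G-closed Γ⊆S α∈ (subst (Left _⊢ᴰ_ G Γ α) (sym eq) (⊢φ , g))))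
            in extend [ χ ] s (modus eq (Saturation.represents s (here refl)))
          reduce (compound c cs) eq _ =
            let c′ , c′∈ , ¬g = find (¬All⇒Any¬ (λ c′ → G? (c′ ++ Γ ∖ α)) (c ∷ cs)
                  (λ gs → ¬G (G-closed Γ⊆S α∈ (subst (Left _⊢ᴰ_ G Γ α) (sym eq) gs))))
                s = continue c′ (subst (λ s → c′ ∈ pieces s) (sym eq) c′∈) ¬g
            in extend c′ s (branch eq c′∈ (λ γ∈ → Saturation.represents s (∈-++⁺ˡ γ∈)))

      saturate : ∀ Γ → Γ ⊆ S → ¬ G Γ → Saturation G Γ
      saturate Γ = saturate-below (suc (weight Γ)) Γ ℕ.≤-refl

    -- Worlds and the canonical model

    -- A test (m , χ) bars the successors along the relation of m that derive χ.
    Untestable : Context → Modality × Fm → Set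
    Untestable Γ (m , χ) = Any (Diamond _⊢ᴰ_ Γ m χ ∘ shape) Γ

    -- The condition `testable` guarantees that each possibility in the context keeps a successor
    -- passing the test.
    record World : Set where
      field
        context     : Context
        context⊆S   : context ⊆ S
        irreducible : Irreducible context
        test        : Maybe (Modality × Fm)
        testable    : MAll.All (λ t → proj₂ t ∈ S × ¬ Untestable context t) test
    open World

    _⊩ᴰ_ : World → Fm → Set
    w ⊩ᴰ φ = Represents (context w) φ

    world : ∀ {G Γ} → Saturation G Γ → World
    world s = record
      { context = result s ; context⊆S = result⊆S s ; irreducible = irreducible s
      ; test = nothing ; testable = MAll.nothing }
      where open Saturation

    -- The empty predicate is closed under left steps because each of them has at least one branch.
    saturate-any : ∀ Γ → Γ ⊆ S → ∃[ w ] (∀ {γ} → γ ∈ Γ → w ⊩ᴰ γ)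
    saturate-any Γ Γ⊆S =
      let s = saturate (λ _ → ⊥) (λ _ → no λ ()) (λ {_} {α} _ _ → nonempty (shape α)) Γ Γ⊆S (λ ())
      in world s , Saturation.represents s
      where
      nonempty : ∀ {Γ α} s → Left _⊢ᴰ_ (λ _ → ⊥) Γ α s → ⊥
      nonempty (implication φ χ) (_ , ())
      nonempty (compound c cs)   (() ∷ _)

    saturate-avoiding : ∀ Γ ψ → Γ ⊆ S → ψ ∈ S → ¬ Γ ⊢ᴰ ψ →
                        ∃[ w ] ((∀ {γ} → γ ∈ Γ → w ⊩ᴰ γ) × ¬ context w ⊢ᴰ ψ)
    saturate-avoiding Γ ψ Γ⊆S ψ∈S ⊬ψ =
      let s = saturate (_⊢ᴰ ψ) (_⊢ᴰ? ψ) (λ Δ⊆S α∈ l → derive Δ⊆S ψ∈S (inj₂ (lose α∈ l))) Γ Γ⊆S ⊬ψ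
      in world s , Saturation.represents s , Saturation.avoids s

    infix 4 _≼_

    -- Inclusion of contexts would be too strict, as contexts lose the formulas that are reduced.
    _≼_ : World → World → Set
    w ≼ w′ = ∀ {φ} → w ⊩ᴰ φ → w′ ⊩ᴰ φ

    -- Depending on the index alone, it interprets modalities identified by `L` by the same
    -- relation, which yields the frame conditions.
    Access : ℕ → World → World → Set
    Access i w w′ =
      (∀ {γ} → γ ∈ content L i (context w) → w′ ⊩ᴰ γ) ×
      MAll.All (λ (m , χ) → index L m ≡ i → ¬ context w′ ⊢ᴰ χ) (test w)

    content-⊆S : ∀ {Γ} i → Γ ⊆ S → content L i Γ ⊆ S
    content-⊆S {Γ} i Γ⊆S {γ} γ∈ =
      let α , m , α∈ , eq = ∈-select⁻ Γ (index L □⁺ ≡ᵇ i) (index L ◇⁻ ≡ᵇ i) γ∈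
      in S-closed (Γ⊆S α∈) (subst (λ s → [ γ ] ∈ pieces s) (sym eq) (here refl)) (here refl)

    possibility-seed-⊆S : ∀ {w α m φ} i → α ∈ context w → shape α ≡ possibility m φ →
                          φ ∷ content L i (context w) ⊆ S
    possibility-seed-⊆S {w} {φ = φ} i α∈ eq (here refl) =
      S-closed (context⊆S w α∈) (subst (λ s → [ φ ] ∈ pieces s) (sym eq) (here refl)) (here refl)
    possibility-seed-⊆S {w} i α∈ eq (there γ∈) = content-⊆S i (context⊆S w) γ∈

    -- Saturate `φ` with the unboxed formulas. A test on another relation imposes nothing; a test
    -- `(m′ , χ)` on this one asks to avoid `χ`, which is possible because a derivation of `χ` from
    -- the seed would make `α` a witness of `Untestable`.
    successor : ∀ w {α m φ} → α ∈ context w → shape α ≡ possibility m φ →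
                ∃[ w′ ] (Access (index L m) w w′ × w′ ⊩ᴰ φ)
    successor w {α} {m} {φ} α∈ eq =
      let w′ , h , avoid = go (test w) (testable w) in w′ , ((h ∘ there) , avoid) , h (here refl)
      where
      i = index L m
      seed = φ ∷ content L i (context w)
      seed⊆S = possibility-seed-⊆S {w} i α∈ eq

      go : ∀ t → MAll.All (λ t → proj₂ t ∈ S × ¬ Untestable (context w) t) t →
           ∃[ w′ ] ((∀ {γ} → γ ∈ seed → w′ ⊩ᴰ γ) ×
                    MAll.All (λ (m′ , χ) → index L m′ ≡ i → ¬ context w′ ⊢ᴰ χ) t)
      go nothing _ = let w′ , h = saturate-any seed seed⊆S in w′ , h , MAll.nothing
      go (just (m′ , χ)) (MAll.just (χ∈S , barred)) with index L m′ ℕ.≟ i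
      ... | no differ = let w′ , h = saturate-any seed seed⊆S in w′ , h , MAll.just (⊥-elim ∘ differ)
      ... | yes same =
        let w′ , h , ⊬χ = saturate-avoiding seed χ seed⊆S χ∈S
              (λ d → barred (lose α∈ (subst (Diamond _⊢ᴰ_ (context w) m′ χ) (sym eq)
                (sym same , subst (λ j → φ ∷ content L j (context w) ⊢ᴰ χ) (sym same) d))))
        in w′ , h , MAll.just (λ _ → ⊬χ)

    canonicalFrame : World → Frame
    canonicalFrame w₀ = record
      { W = World ; nonempty = w₀ ; _≤_ = _≼_
      ; isPreorder = record
          { isEquivalence = isEquivalence
          ; reflexive = λ { refl r → r }
          ; trans = λ w≼ ≼w r → ≼w (w≼ r) }
      ; R□⁺ = Access (index L □⁺) ; R□⁻ = Access (index L □⁻)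
      ; R◇⁺ = Access (index L ◇⁺) ; R◇⁻ = Access (index L ◇⁻) }

    module _ (w₀ : World) where

      relation-access : ∀ m → relation (canonicalFrame w₀) m ≡ Access (index L m)
      relation-access □⁺ = refl
      relation-access □⁻ = refl
      relation-access ◇⁺ = refl
      relation-access ◇⁻ = refl

      canonical-frameOf : FrameOf L (canonicalFrame w₀)
      canonical-frameOf = frameOf L _ λ m m′ eq → equal⇒⇔
        (trans (relation-access m) (trans (cong Access eq) (sym (relation-access m′))))
        where
        equal⇒⇔ : ∀ {R R′ : Rel World 0ℓ} → R ≡ R′ → R ⇔ R′
        equal⇒⇔ refl = id , id

      canonicalModel : Model Var (canonicalFrame w₀)
      canonicalModel = record
        { v⁺ = λ p w → w ⊩ᴰ var p ; v⁻ = λ p w → w ⊩ᴰ ∼ var p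
        ; v⁺-upward = λ p w≼w′ → w≼w′ ; v⁻-upward = λ p w≼w′ → w≼w′ }

      -- Support by shapes, and the truth lemma

      infix 4 _⊩_

      _⊩_ : World → Fm → Set
      w ⊩ φ = _⊩⁺_ canonicalModel w φ

      -- Restating support along shapes reduces the truth lemma to five cases.
      Forces : World → Fm → Shape Var → Set
      Forces w α literal           = w ⊩ᴰ α
      Forces w α (implication φ χ) = ∀ w′ → w ≼ w′ → w′ ⊩ φ → w′ ⊩ χ
      Forces w α (compound c cs)   = Any (All (w ⊩_)) (c ∷ cs)
      Forces w α (necessity m φ)   = ∀ w′ → w ≼ w′ → ∀ w″ → Access (index L m) w′ w″ → w″ ⊩ φ
      Forces w α (possibility m φ) = ∀ w′ → w ≼ w′ → ∃[ w″ ] (Access (index L m) w′ w″ × w″ ⊩ φ)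

      forces : ∀ {w} α → w ⊩ α → Forces w α (shape α)
      forces (var p)     r        = r
      forces (φ ∧ χ)     (r , r′) = here (r ∷ r′ ∷ [])
      forces (φ ∨ χ)     (inj₁ r) = here (r ∷ [])
      forces (φ ∨ χ)     (inj₂ r) = there (here (r ∷ []))
      forces (φ ⊃ χ)     r        = r
      forces (□ φ)       r        = r
      forces (◇ φ)       r        = r
      forces (∼ var p)   r        = r
      forces (∼ ∼ φ)     r        = here (r ∷ [])
      forces (∼ (φ ∧ χ)) (inj₁ r) = here (r ∷ [])
      forces (∼ (φ ∧ χ)) (inj₂ r) = there (here (r ∷ []))
      forces (∼ (φ ∨ χ)) (r , r′) = here (r ∷ r′ ∷ [])
      forces (∼ (φ ⊃ χ)) (r , r′) = here (r ∷ r′ ∷ [])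
      forces (∼ □ φ)     r        = r
      forces (∼ ◇ φ)     r        = r

      forced : ∀ {w} α → Forces w α (shape α) → w ⊩ α
      forced (var p)     r                     = r
      forced (φ ∧ χ)     (here (r ∷ r′ ∷ []))  = r , r′
      forced (φ ∨ χ)     (here (r ∷ []))       = inj₁ r
      forced (φ ∨ χ)     (there (here (r ∷ []))) = inj₂ r
      forced (φ ⊃ χ)     r                     = r
      forced (□ φ)       r                     = r
      forced (◇ φ)       r                     = r
      forced (∼ var p)   r                     = r
      forced (∼ ∼ φ)     (here (r ∷ []))       = r
      forced (∼ (φ ∧ χ)) (here (r ∷ []))       = inj₁ r
      forced (∼ (φ ∧ χ)) (there (here (r ∷ []))) = inj₂ r
      forced (∼ (φ ∨ χ)) (here (r ∷ r′ ∷ []))  = r , r′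
      forced (∼ (φ ⊃ χ)) (here (r ∷ r′ ∷ []))  = r , r′
      forced (∼ □ φ)     r                     = r
      forced (∼ ◇ φ)     r                     = r

      -- The halves are proved together because each uses the other at the antecedent of an
      -- implication.
      record Truth (α : Fm) : Set where
        field
          represented⇒true : ∀ {w} → w ⊩ᴰ α → w ⊩ α
          true⇒derivable   : ∀ {w} → α ∈ S → w ⊩ α → context w ⊢ᴰ α
      open Truth

      module _ {α : Fm} where

        represented⇒Forces : ∀ s → shape α ≡ s → (∀ {c γ} → c ∈ pieces s → γ ∈ c → Truth γ) →
                             (∀ {c} → α ∈ S → c ∈ pieces s → c ⊆ S) →
                             ∀ {w} → w ⊩ᴰ α → Forces w α s
        represented⇒Forces literal eq ih ⊆S r = r
        represented⇒Forces (implication φ χ) eq ih ⊆S r w′ w≼w′ ⊩φ with w≼w′ r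
        -- An implication stays in an irreducible context only while its antecedent is underivable,
        -- but a forced antecedent is derivable.
        ... | member α∈ = ⊥-elim (irreducible w′ α∈ (subst (Reducible (context w′)) (sym eq)
          (true⇒derivable (ih (here refl) (here refl))
            (⊆S (context⊆S w′ α∈) (here refl) (here refl)) ⊩φ)))
        ... | modus eq′ r′ with refl ← trans (sym eq) eq′ =
          represented⇒true (ih (there (here refl)) (here refl)) r′
        ... | branch eq′ _ _ with () ← trans (sym eq) eq′
        represented⇒Forces (compound c cs) eq ih ⊆S {w} (member α∈) =
          ⊥-elim (irreducible w α∈ (subst (Reducible (context w)) (sym eq) tt))
        represented⇒Forces (compound c cs) eq ih ⊆S (modus eq′ _) with () ← trans (sym eq) eq′
        represented⇒Forces (compound c cs) eq ih ⊆S (branch eq′ c∈ r) with refl ← trans (sym eq) eq′ =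
          lose c∈ (All.tabulate λ γ∈ → represented⇒true (ih c∈ γ∈) (r γ∈))
        represented⇒Forces (necessity m χ) eq ih ⊆S r w′ w≼w′ w″ (transferred , _) with w≼w′ r
        ... | member α∈ = represented⇒true (ih (here refl) (here refl)) (transferred (∈-unboxed⁺ L α∈ eq))
        ... | modus eq′ _ with () ← trans (sym eq) eq′
        ... | branch eq′ _ _ with () ← trans (sym eq) eq′
        represented⇒Forces (possibility m φ) eq ih ⊆S r w′ w≼w′ with w≼w′ r
        ... | member α∈ =
          let w″ , access , r′ = successor w′ α∈ eq
          in w″ , access , represented⇒true (ih (here refl) (here refl)) r′
        ... | modus eq′ _ with () ← trans (sym eq) eq′
        ... | branch eq′ _ _ with () ← trans (sym eq) eq′

        -- For implications and modalities, decidability permits arguing by contradiction: if the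
        -- right premise fails, saturation or a test supplies a world that contradicts the forcing
        -- condition.
        Forces⇒Right : ∀ s → shape α ≡ s → (∀ {c γ} → c ∈ pieces s → γ ∈ c → Truth γ) →
                       (∀ {c} → c ∈ pieces s → c ⊆ S) →
                       ∀ {w} → Forces w α s → Right _⊢ᴰ_ (context w) α s
        Forces⇒Right literal eq ih ⊆S (member α∈) = α∈
        Forces⇒Right literal eq ih ⊆S (modus eq′ _) with () ← trans (sym eq) eq′
        Forces⇒Right literal eq ih ⊆S (branch eq′ _ _) with () ← trans (sym eq) eq′
        Forces⇒Right (implication φ χ) eq ih ⊆S {w} f =
          decidable-stable (φ ∷ context w ⊢ᴰ? χ) λ ⊬χ →
            let χ∈S = ⊆S (there (here refl)) (here refl)
                w′ , r , ⊬χ′ = saturate-avoiding (φ ∷ context w) χ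
                  (∈-∷⁺ʳ (⊆S (here refl) (here refl)) (context⊆S w)) χ∈S ⊬χ
                ⊩φ = represented⇒true (ih (here refl) (here refl)) (r (here refl))
            in ⊬χ′ (true⇒derivable (ih (there (here refl)) (here refl)) χ∈S
                 (f w′ (represents-trans (r ∘ there)) ⊩φ))
        Forces⇒Right (compound c cs) eq ih ⊆S f =
          let c′ , c′∈ , ⊩c′ = find f
          in lose c′∈ (All.tabulate λ γ∈ →
               true⇒derivable (ih c′∈ γ∈) (⊆S c′∈ γ∈) (All.lookup ⊩c′ γ∈))
        Forces⇒Right (necessity m χ) eq ih ⊆S {w} f =
          decidable-stable (unboxed L m (context w) ⊢ᴰ? χ) λ ⊬χ →
            let χ∈S = ⊆S (here refl) (here refl)
                w″ , r , ⊬χ′ = saturate-avoiding (unboxed L m (context w)) χ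
                  (content-⊆S (index L m) (context⊆S w)) χ∈S ⊬χ
                -- The context is unchanged, so `w′` lies above `w`; without a test its successors
                -- include the world at which `χ` is underivable.
                w′ = record w { test = nothing ; testable = MAll.nothing }
            in ⊬χ′ (true⇒derivable (ih (here refl) (here refl)) χ∈S (f w′ id w″ (r , MAll.nothing)))
        Forces⇒Right (possibility m χ) eq ih ⊆S {w} f =
          decidable-stable (any? (diamond? _⊢ᴰ?_ (context w) m χ ∘ shape) (context w)) λ barred →
            let χ∈S = ⊆S (here refl) (here refl)
                -- Again above `w`. The failure of the right premise is exactly what admits this
                -- test, after which no successor along `m` derives `χ`.
                w′ = record w { test = just (m , χ) ; testable = MAll.just (χ∈S , barred) }
            in case f w′ id of λ where
                 (_ , (_ , MAll.just ⊬χ) , ⊩χ) →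
                   ⊬χ refl (true⇒derivable (ih (here refl) (here refl)) χ∈S ⊩χ)

      truth-below : ∀ n α → size α < n → Truth α
      truth-below (suc n) α lt = record
        { represented⇒true = λ r →
            forced α (represented⇒Forces (shape α) refl ih (λ α∈S → S-closed α∈S) r)
        ; true⇒derivable = λ {w} α∈S ⊩α → derive (context⊆S w) α∈S
            (inj₁ (Forces⇒Right (shape α) refl ih (S-closed α∈S) (forces α ⊩α))) }
        where
        ih : ∀ {c γ} → c ∈ pieces (shape α) → γ ∈ c → Truth γ
        ih c∈ γ∈ = truth-below n _ (ℕ.<-≤-trans (piece-size α c∈ γ∈) (ℕ.≤-pred lt))

      truth : ∀ α → Truth α
      truth α = truth-below (suc (size α)) α ℕ.≤-refl

      -- Completeness

      ⊩-⋀ : ∀ {w} ψ Γ → (∀ {γ} → γ ∈ ψ ∷ Γ → w ⊩ γ) → w ⊩ foldr₁ _∧_ (ψ ∷ Γ)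
      ⊩-⋀ ψ []      h = h (here refl)
      ⊩-⋀ ψ (χ ∷ Γ) h = h (here refl) , ⊩-⋀ χ Γ (h ∘ there)

      valid⇒⊩ : ∀ {w} Γ {φ} → L ⊨ (Γ ⋀⊃ φ) → (∀ {γ} → γ ∈ Γ → w ⊩ γ) → w ⊩ φ
      valid⇒⊩ {w} []      valid h = valid _ canonical-frameOf canonicalModel w
      valid⇒⊩ {w} (ψ ∷ Γ) valid h = valid _ canonical-frameOf canonicalModel w w id (⊩-⋀ ψ Γ h)

    complete : ∀ {Γ φ} → Γ ⊆ S → φ ∈ S → L ⊨ (Γ ⋀⊃ φ) → L ⊢ (Γ ⇒ φ)
    complete {Γ} {φ} Γ⊆S φ∈S valid = ⊢ᴰ-sound (decidable-stable (Γ ⊢ᴰ? φ) λ ⊬φ →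
      let w , r , ⊬φ′ = saturate-avoiding Γ φ Γ⊆S φ∈S ⊬φ
          open Truth
      in ⊬φ′ (true⇒derivable (truth w φ) φ∈S
           (valid⇒⊩ w {w} Γ valid (λ {γ} γ∈ → represented⇒true (truth w γ) (r γ∈)))))

theorem6 : {Var : Set} → Var ↣ ℕ → (L : Logic) (Γ : List (Formula Var)) (φ : Formula Var) → L ⊨ (Γ ⋀⊃ φ) → L ⊢ (Γ ⇒ φ)
theorem6 Var↣ℕ L Γ φ = complete (S⊇ ∘ there) (S⊇ (here refl))
  where
  S⊇ = ⊆-concatMap-closure (φ ∷ Γ)
  -- Countability provides decidable equality of variables, hence of formulas.
  open Calculus L (formula-≟ (via-injection Var↣ℕ ℕ._≟_))
  open Canonical (concatMap closure (φ ∷ Γ)) (concatMap-closure-closed (φ ∷ Γ))
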